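{- Let $\mathcal C$ be a topologically closed class of finite graphs. The following are equivalent: (1) $\mathcal C$ has bounded expansion; (2) $\mathcal C$ has all restricted dualities; (3) for every odd integer $g$ there exists a graph $H_g$ with odd-girth greater than $g$ such that every graph $G\in\mathcal C$ with odd-girth greater than $g$ has a homomorphism to $H_g$.
   Context: Graphs are finite, simple and undirected. $\mathcal C$ is topologically closed if every subdivision of a graph in $\mathcal C$ is in $\mathcal C$. A $\le k$-subdivision of $H$ replaces each edge of $H$ by a path of length at most $k+1$; for a half-integer $p$, $H$ is a shallow topological minor of $G$ at depth $p$ if some $\le 2p$-subdivision of $H$ is a subgraph of $G$. $\mathcal C$ has bounded expansion if for every integer $p$ the average degrees of the shallow minors at depth $p$ of graphs in $\mathcal C$ are bounded (equivalently, the average degrees of shallow topological minors at depth $p$ of graphs in $\mathcal C$ are bounded). $\mathcal C$ has all restricted dualities if for every non-empty connected graph $F$ there is a graph $D$ with $F\nrightarrow D$ such that for every $G\in\mathcal C$: $F\to G$ if and only if $G\nrightarrow D$ ($\to$ denotes existence of a homomorphism). The odd-girth of a graph is the length of its shortest odd cycle. -}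

module Defs where

open import Data.Nat using (ℕ; zero; suc; _+_; _*_; _≤_)
open import Data.Fin using (Fin; zero; suc; inject₁; fromℕ)
open import Data.Fin.Properties using (_≟_)
open import Data.Bool using (Bool; true; false; _∧_; _∨_; not; if_then_else_)
open import Data.Bool.Properties using (∧-comm; ∨-comm)
open import Data.Maybe using (Maybe; just)
open import Data.List using (List; map; allFin)
open import Data.Nat.ListAction using (sum)
open import Data.Product using (Σ; ∃; ∃-syntax; _×_; _,_)
open import Data.Empty using (⊥)
open import Data.Unit using (⊤)
open import Relation.Nullary using (¬_)
open import Relation.Nullary.Decidable using (⌊_⌋)
open import Relation.Binary.PropositionalEquality using (_≡_; refl; cong₂; trans)
open import Function.Bundles using (_⤖_; Bijection)

record Graph : Set where
  field
    n     : ℕ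
    adj   : Fin n → Fin n → Bool
    adj-sym : ∀ u v → adj u v ≡ adj v u
    adj-irr : ∀ v → adj v v ≡ false
open Graph public

Class : Set₁
Class = Graph → Set

_⟶_ : Graph → Graph → Set
G ⟶ H = Σ (Fin (n G) → Fin (n H)) λ f →
          ∀ u v → adj G u v ≡ true → adj H (f u) (f v) ≡ true

_≅_ : Graph → Graph → Set
G ≅ H = Σ (Fin (n G) ⤖ Fin (n H)) λ f →
          ∀ u v → adj H (Bijection.to f u) (Bijection.to f v) ≡ adj G u v

-- Subdividing one edge uv of G: new vertex zero, old vertices suc x.

private
  isPair : ∀ {m} (u v x y : Fin m) → Bool
  isPair u v x y = (⌊ x ≟ u ⌋ ∧ ⌊ y ≟ v ⌋) ∨ (⌊ x ≟ v ⌋ ∧ ⌊ y ≟ u ⌋)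

  isPair-sym : ∀ {m} (u v x y : Fin m) → isPair u v x y ≡ isPair u v y x
  isPair-sym u v x y =
    trans (cong₂ _∨_ (∧-comm ⌊ x ≟ u ⌋ ⌊ y ≟ v ⌋) (∧-comm ⌊ x ≟ v ⌋ ⌊ y ≟ u ⌋))
          (∨-comm (⌊ y ≟ v ⌋ ∧ ⌊ x ≟ u ⌋) (⌊ y ≟ u ⌋ ∧ ⌊ x ≟ v ⌋))

  endpoint : ∀ {m} (u v x : Fin m) → Bool
  endpoint u v x = ⌊ x ≟ u ⌋ ∨ ⌊ x ≟ v ⌋

subdivideEdge : (G : Graph) → Fin (n G) → Fin (n G) → Graph
subdivideEdge G u v = record
  { n = suc (n G) ; adj = A ; adj-sym = S ; adj-irr = I }
  where
  A : Fin (suc (n G)) → Fin (suc (n G)) → Bool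
  A zero    zero    = false
  A zero    (suc y) = endpoint u v y
  A (suc x) zero    = endpoint u v x
  A (suc x) (suc y) = adj G x y ∧ not (isPair u v x y)
  S : ∀ a b → A a b ≡ A b a
  S zero    zero    = refl
  S zero    (suc y) = refl
  S (suc x) zero    = refl
  S (suc x) (suc y) = cong₂ (λ p q → p ∧ not q) (adj-sym G x y) (isPair-sym u v x y)
  I : ∀ a → A a a ≡ false
  I zero    = refl
  I (suc x) = cong₂ (λ p q → p ∧ not q) (adj-irr G x) (refl {x = isPair u v x x})

data IsSubdivisionOf : Graph → Graph → Set where
  isoSub : ∀ {G H} → G ≅ H → IsSubdivisionOf G H
  stepSub : ∀ {G H} → IsSubdivisionOf G H → (u v : Fin (n G)) →
            adj G u v ≡ true → IsSubdivisionOf (subdivideEdge G u v) H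

TopologicallyClosed : Class → Set
TopologicallyClosed C = ∀ G H → C H → IsSubdivisionOf G H → C G

data Walk (G : Graph) (P : Fin (n G) → Set) : ℕ → Fin (n G) → Fin (n G) → Set where
  here : ∀ {k x} → P x → Walk G P k x x
  step : ∀ {k x y z} → P x → adj G x y ≡ true → Walk G P k y z → Walk G P (suc k) x z

-- Shallow minors at depth r: H is a minor of G whose branch sets
-- (σ⁻¹(just v)) are disjoint, and each induces a subgraph of radius ≤ r.

record ShallowMinor (r : ℕ) (H G : Graph) : Set where
  field
    σ         : Fin (n G) → Maybe (Fin (n H))
    center    : Fin (n H) → Fin (n G)
    center-in : ∀ v → σ (center v) ≡ just v
    radius    : ∀ v x → σ x ≡ just v → Walk G (λ y → σ y ≡ just v) r (center v) x
    edges     : ∀ u v → adj H u v ≡ true →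
                ∃[ x ] ∃[ y ] (σ x ≡ just u × σ y ≡ just v × adj G x y ≡ true)

degree : (G : Graph) → Fin (n G) → ℕ
degree G v = sum (map (λ u → if adj G v u then 1 else 0) (allFin (n G)))

degreeSum : Graph → ℕ
degreeSum G = sum (map (degree G) (allFin (n G)))

-- Bounded expansion: for every depth r the average degree 2|E(H)|/|V(H)|
-- of shallow minors H at depth r of graphs in C is bounded (by some c).
BoundedExpansion : Class → Set
BoundedExpansion C = ∀ (r : ℕ) → ∃[ c ] ∀ G H → C G → ShallowMinor r H G →
                       degreeSum H ≤ c * n H

Connected : Graph → Set
Connected G = ∀ x y → ∃[ k ] Walk G (λ _ → ⊤) k x y

NonEmpty : Graph → Set
NonEmpty G = 1 ≤ n G

HasAllRestrictedDualities : Class → Set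
HasAllRestrictedDualities C =
  ∀ F → NonEmpty F → Connected F →
    ∃[ D ] (¬ (F ⟶ D) × (∀ G → C G → (F ⟶ G → ¬ (G ⟶ D)) × (¬ (G ⟶ D) → F ⟶ G)))

Odd : ℕ → Set
Odd m = ∃[ t ] m ≡ suc (2 * t)

-- A cycle of length suc k (k ≥ 2): distinct vertices c 0, …, c k with
-- c j ~ c (j+1) and c k ~ c 0.
record Cycle (G : Graph) (k : ℕ) : Set where
  field
    long  : 2 ≤ k
    c     : Fin (suc k) → Fin (n G)
    inj   : ∀ i j → c i ≡ c j → i ≡ j
    cons  : ∀ (j : Fin k) → adj G (c (inject₁ j)) (c (suc j)) ≡ true
    close : adj G (c (fromℕ k)) (c zero) ≡ true

-- odd-girth(G) > g  (the odd-girth of a graph without odd cycles is ∞)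
OddGirthGT : Graph → ℕ → Set
OddGirthGT G g = ∀ k → Odd (suc k) → suc k ≤ g → ¬ Cycle G k

HomUniversalOddGirth : Class → Set
HomUniversalOddGirth C =
  ∀ g → Odd g → ∃[ H ] (OddGirthGT H g × (∀ G → C G → OddGirthGT G g → G ⟶ H))

{-# OPTIONS --safe #-}
module Submission where

-- (1) ⇒ (2). Sparsity of shallow minors yields a vertex order in which every vertex weakly reaches
-- boundedly many others, hence a colouring with boundedly many colours such that a short walk
-- containing a smallest vertex contains its colour only once. Consequently |F| colour classes induce
-- a graph that can be dismantled by repeatedly removing a root from every component, and such a
-- graph is homomorphically equivalent to a subset of a fixed finite graph. The truncated product of
-- these subsets over all sets of |F| colours receives G, and F maps to it only if F maps to G;
-- the dual is the disjoint union of the finitely many such products to which F does not map.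
--
-- (2) ⇒ (3). Use the dual of the cycle of length g. For g = 1 pass through (1), as bounded
-- expansion bounds the chromatic number.
--
-- (3) ⇒ (1). Given a shallow minor H of G ∈ C and a set of edges of H, subdivide G so that the
-- centres of adjacent branch sets are joined by paths of length ℓ or ℓ + 1 according to that set,
-- while no odd cycle has length at most g = 2ℓ + 1. A homomorphism to H_g, restricted to the
-- centres, determines the set: otherwise H_g contains a closed odd walk of length g.
-- Hence 2^|E(H)| ≤ |H_g|^|V(H)|.

open import Defs
open import Data.Bool using (Bool; true; false; _∧_; _∨_; not; if_then_else_)
open import Data.Bool.Properties using (∧-zeroʳ; ∨-comm; ∨-identityʳ)
open import Data.Empty using (⊥; ⊥-elim)
open import Data.Fin using (Fin; zero; suc; toℕ; fromℕ; fromℕ<; inject₁; combine; remQuot; funToFin; finToFun; splitAt; _↑ˡ_; _↑ʳ_)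
open import Data.Fin.Properties using (_≟_; any?; all?; injective⇒≤; finToFun-funToFin; funToFin-finToFin; remQuot-combine; combine-remQuot; splitAt-↑ˡ; splitAt-↑ʳ; toℕ-inject₁; toℕ-fromℕ; toℕ-injective; toℕ<n)
open import Data.List using (List; []; _∷_; length; filter; allFin; tabulate; lookup; map; concatMap)
open import Data.List.Membership.Propositional using (_∈_; _∉_)
open import Data.List.Membership.Propositional.Properties using (∈-filter⁺; ∈-filter⁻; ∈-allFin; ∈-concatMap⁺; ∈-map⁺)
open import Data.List.Properties using (map-tabulate; length-map; length-++)
open import Data.List.Relation.Unary.Any using (here; there)
open import Data.List.Relation.Unary.Any.Properties using (lookup-index)
open import Data.Maybe using (Maybe; just; nothing; _>>=_; is-just; fromMaybe)
open import Data.Maybe.Properties using (≡-dec; just-injective)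
open import Data.Nat using (ℕ; zero; suc; parity; _+_; _*_; _^_; _∸_; _≤_; _<_; _≤?_; _<?_; z≤n; s≤s; s≤s⁻¹)
open import Data.Nat.Tactic.RingSolver using (solve-∀)
open import Data.Parity.Base using (0ℙ; 1ℙ; _⁻¹) renaming (_+_ to _ℙ+_)
open import Data.Product using (∃; _×_; _,_; proj₁; proj₂)
open import Data.Sum using (_⊎_; inj₁; inj₂; [_,_]′; swap)
open import Data.Unit using (⊤; tt)
open import Function using (_∘_; id)
open import Function.Bundles using (_⇔_; mk⇔)
open import Function.Construct.Identity using (⤖-id)
open import Relation.Binary.Definitions using (tri<; tri≈; tri>)
open import Relation.Nullary using (Dec; yes; no; ¬_; contradiction)
open import Relation.Nullary.Decidable using (⌊_⌋; _×-dec_; _⊎-dec_; _→-dec_; ¬?; map′)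
open import Data.Nat.Properties hiding (_≟_)
open import Relation.Binary.PropositionalEquality
import Data.Bool as Bool
import Data.List.Relation.Unary.Any as Any
import Data.Maybe as Maybe
import Data.Nat.ListAction as ListAction
import Data.Nat.Properties as ℕ
import Data.Parity.Properties as Parity
import Data.Product as Product

open import Algebra.Properties.CommutativeMonoid.Sum +-0-commutativeMonoid
  using (sum; sum-cong-≗; ∑-distrib-+; ∑-comm; sum-replicate-zero)

-- Finite sums and counting

-- Contracting balls around vertices gives a minor only if the balls are disjoint, which they are
-- not. So, before a vertex is picked from the remaining set `S`, vertices of `S` are linked by
-- short walks for as long as possible. The links form a shallow minor: they occupy at most a
-- bounded multiple of `count S` vertices, and they can be coloured properly with boundedly many
-- colours. Balls around vertices of one colour are then disjoint, and contracting them bounds the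
-- average number of places where short walks leave a ball.
--
-- The dual must not depend on `G`. What it remembers of `G` is, for each small colour set, the
-- subset of the universal graph that is realised, one of finitely many. The subset rather than the
-- whole universal graph is kept because only from the subset is there a homomorphism back to `G`.
--
-- In the last implication, edges inside a branch set get length 1 or 2 so that it becomes bipartite
-- by depth. A closed walk cannot change branch sets exactly once; if it does so twice, it repeats
-- the same distance between centres and stays even; from three changes on it is too long.

ι : Bool → ℕ
ι b = if b then 1 else 0

ι≤1 : ∀ b → ι b ≤ 1
ι≤1 true = ≤-refl
ι≤1 false = z≤n

ι-mono : ∀ {b b′} → (b ≡ true → b′ ≡ true) → ι b ≤ ι b′
ι-mono {false} h = z≤n
ι-mono {true} h rewrite h refl = ≤-refl

Subset : ℕ → Set
Subset m = Fin m → Bool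

count : ∀ {m} → Subset m → ℕ
count S = sum (ι ∘ S)

true≢false : ∀ {b} → b ≡ true → b ≡ false → ⊥
true≢false refl ()

¬true⇒false : ∀ {b} → ¬ b ≡ true → b ≡ false
¬true⇒false {true} h = ⊥-elim (h refl)
¬true⇒false {false} h = refl

∧-true : ∀ {b c} → b ≡ true → c ≡ true → b ∧ c ≡ true
∧-true refl refl = refl

∧-true⁻ : ∀ b {c} → b ∧ c ≡ true → b ≡ true × c ≡ true
∧-true⁻ true h = refl , h

bool-ext : ∀ {b b′} → (b ≡ true → b′ ≡ true) → (b′ ≡ true → b ≡ true) → b ≡ b′
bool-ext {true} f g = sym (f refl)
bool-ext {false} {true} f g = g refl
bool-ext {false} {false} f g = refl

⌊⌋-true : ∀ {A : Set} (d : Dec A) → A → ⌊ d ⌋ ≡ true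
⌊⌋-true (yes _) _ = refl
⌊⌋-true (no ¬a) a = ⊥-elim (¬a a)

⌊⌋-true⁻ : ∀ {A : Set} (d : Dec A) → ⌊ d ⌋ ≡ true → A
⌊⌋-true⁻ (yes a) _ = a

⌊⌋-false : ∀ {A : Set} (d : Dec A) → ¬ A → ⌊ d ⌋ ≡ false
⌊⌋-false (yes a) ¬a = ⊥-elim (¬a a)
⌊⌋-false (no _) _ = refl

sum-mono-≤ : ∀ {m} {f g : Fin m → ℕ} → (∀ i → f i ≤ g i) → sum f ≤ sum g
sum-mono-≤ {zero} h = z≤n
sum-mono-≤ {suc m} h = +-mono-≤ (h zero) (sum-mono-≤ (h ∘ suc))

sum-mono-< : ∀ {m} {f g : Fin m → ℕ} → (∀ i → f i ≤ g i) →
             ∀ i → f i < g i → sum f < sum g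
sum-mono-< h zero lt = +-mono-<-≤ lt (sum-mono-≤ (h ∘ suc))
sum-mono-< h (suc i) lt = +-mono-≤-< (h zero) (sum-mono-< (h ∘ suc) i lt)

sum-const : ∀ m c → sum {m} (λ _ → c) ≡ m * c
sum-const zero c = refl
sum-const (suc m) c = cong (c +_) (sum-const m c)

sum-*ˡ : ∀ {m} c (f : Fin m → ℕ) → sum (λ i → c * f i) ≡ c * sum f
sum-*ˡ {zero} c f = sym (*-zeroʳ c)
sum-*ˡ {suc m} c f = trans (cong (c * f zero +_) (sum-*ˡ c (f ∘ suc))) (sym (*-distribˡ-+ c (f zero) _))

≤-sum : ∀ {m} (f : Fin m → ℕ) i → f i ≤ sum f
≤-sum f zero = m≤m+n _ _
≤-sum f (suc i) = ≤-trans (≤-sum (f ∘ suc) i) (m≤n+m _ _)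

sum-zero : ∀ {m} {f : Fin m → ℕ} → (∀ i → f i ≡ 0) → sum f ≡ 0
sum-zero {m} h = trans (sum-cong-≗ h) (sum-replicate-zero m)

sum-point : ∀ {m} (f : Fin m → ℕ) j → sum (λ i → if ⌊ i ≟ j ⌋ then f i else 0) ≡ f j
sum-point {suc m} f zero = trans (cong (f zero +_) (sum-zero {m} {λ i → if ⌊ suc i ≟ zero ⌋ then f (suc i) else 0} λ _ → refl)) (+-identityʳ _)
sum-point f (suc j) = trans (sum-cong-≗ (λ i → cong (λ b → if b then f (suc i) else 0) (lemma i))) (sum-point (f ∘ suc) j)
  where
  lemma : ∀ i → ⌊ suc i ≟ suc j ⌋ ≡ ⌊ i ≟ j ⌋
  lemma i with i ≟ j
  ... | yes _ = refl
  ... | no _ = refl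

count-mono : ∀ {m} {S S′ : Subset m} → (∀ i → S i ≡ true → S′ i ≡ true) → count S ≤ count S′
count-mono h = sum-mono-≤ (λ i → ι-mono (h i))

count-mono-< : ∀ {m} {S S′ : Subset m} → (∀ i → S i ≡ true → S′ i ≡ true) →
               ∀ i → S i ≡ false → S′ i ≡ true → count S < count S′
count-mono-< {S = S} {S′} h i eq eq′ = sum-mono-< (λ i → ι-mono (h i)) i lt
  where
  lt : ι (S i) < ι (S′ i)
  lt rewrite eq | eq′ = ≤-refl

count≤n : ∀ {m} (S : Subset m) → count S ≤ m
count≤n {m} S = ≤-trans (sum-mono-≤ (λ i → ι≤1 (S i))) (≤-reflexive (trans (sum-const m 1) (*-identityʳ m)))

count≥1 : ∀ {m} (S : Subset m) i → S i ≡ true → 1 ≤ count S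
count≥1 S i eq = ≤-trans (≤-reflexive (cong ι (sym eq))) (≤-sum (ι ∘ S) i)

infixl 6 _─_
_─_ : ∀ {m} → Subset m → Fin m → Subset m
(S ─ v) u = S u ∧ not ⌊ u ≟ v ⌋

─-true : ∀ {m} (S : Subset m) {v u} → S u ≡ true → ¬ u ≡ v → (S ─ v) u ≡ true
─-true S {v} {u} Su u≢v rewrite Su | ⌊⌋-false (u ≟ v) u≢v = refl

─-true⁻ : ∀ {m} (S : Subset m) {v u} → (S ─ v) u ≡ true → S u ≡ true × ¬ u ≡ v
─-true⁻ S {v} {u} h with S u | u ≟ v
... | true | no ¬p = refl , ¬p

count-─ : ∀ {m} (S : Subset m) v → S v ≡ true → count (S ─ v) < count S
count-─ S v Sv = count-mono-< (λ i h → proj₁ (─-true⁻ S h)) v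
  (¬true⇒false (λ h → proj₂ (─-true⁻ S h) refl)) Sv

members : ∀ {m} → Subset m → List (Fin m)
members S = filter (λ i → S i Bool.≟ true) (allFin _)

length-members : ∀ {m} (S : Subset m) → length (members S) ≡ count S
length-members S = go S id
  where
  go : ∀ {m k} (S : Subset m) (f : Fin k → Fin m) →
       length (filter (λ i → S i Bool.≟ true) (tabulate f)) ≡ sum (ι ∘ S ∘ f)
  go {k = zero} S f = refl
  go {k = suc k} S f with S (f zero)
  ... | true = cong suc (go S (f ∘ suc))
  ... | false = go S (f ∘ suc)

∈-members : ∀ {m} (S : Subset m) {i} → S i ≡ true → i ∈ members S
∈-members S {i} h = ∈-filter⁺ (λ i → S i Bool.≟ true) (∈-allFin i) h

∈-members⁻ : ∀ {m} (S : Subset m) {i} → i ∈ members S → S i ≡ true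
∈-members⁻ S {i} h = proj₂ (∈-filter⁻ (λ i → S i Bool.≟ true) {xs = allFin _} h)

list-sum : ∀ {m} (f : Fin m → ℕ) → ListAction.sum (map f (allFin m)) ≡ sum f
list-sum f = trans (cong ListAction.sum (map-tabulate id f)) (go f)
  where
  go : ∀ {m} (f : Fin m → ℕ) → ListAction.sum (tabulate f) ≡ sum f
  go {zero} f = refl
  go {suc m} f = cong (f zero +_) (go (f ∘ suc))

degreeSum-sum : ∀ G → degreeSum G ≡ sum (λ u → count (adj G u))
degreeSum-sum G = trans (list-sum (degree G)) (sum-cong-≗ (λ u → list-sum (λ v → ι (adj G u v))))

-- The partial inverse `index` turns branch maps with values in V(G) into branch maps of the
-- reindexed minor; `sum-en` does the same for degree sums.
record Enum {m} (S : Subset m) : Set where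
  field
    size : ℕ
    en : Fin size → Fin m
    index : Fin m → Maybe (Fin size)
    en-∈ : ∀ i → S (en i) ≡ true
    index-en : ∀ i → index (en i) ≡ just i
    en-index : ∀ x i → index x ≡ just i → en i ≡ x
    sum-en : ∀ (f : Fin m → ℕ) → sum (f ∘ en) ≡ sum (λ x → if S x then f x else 0)

  en-injective : ∀ {i j} → en i ≡ en j → i ≡ j
  en-injective {i} {j} eq with trans (sym (index-en i)) (trans (cong index eq) (index-en j))
  ... | refl = refl

  size≡count : size ≡ count S
  size≡count = trans (sym (trans (sum-const size 1) (*-identityʳ size))) (sum-en (λ _ → 1))

enum : ∀ {m} (S : Subset m) → Enum S
enum {zero} S = record { size = 0 ; en = λ () ; index = λ () ; en-∈ = λ () ; index-en = λ ()
                       ; en-index = λ () ; sum-en = λ f → refl }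
enum {suc m} S with enum (S ∘ suc) | S zero in S0
... | E | true = record
  { size = suc E.size ; en = en ; index = index ; en-∈ = en-∈ ; index-en = index-en
  ; en-index = en-index ; sum-en = λ f → sum-en f }
  where
  module E = Enum E
  en : Fin (suc E.size) → Fin (suc m)
  en zero = zero
  en (suc i) = suc (E.en i)
  index : Fin (suc m) → Maybe (Fin (suc E.size))
  index zero = just zero
  index (suc x) = Maybe.map suc (E.index x)
  en-∈ : ∀ i → S (en i) ≡ true
  en-∈ zero = S0
  en-∈ (suc i) = E.en-∈ i
  index-en : ∀ i → index (en i) ≡ just i
  index-en zero = refl
  index-en (suc i) rewrite E.index-en i = refl
  en-index : ∀ x i → index x ≡ just i → en i ≡ x
  en-index zero .zero refl = refl
  en-index (suc x) i eq with E.index x in eq′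
  en-index (suc x) .(suc j) refl | just j = cong suc (E.en-index x j eq′)
  sum-en : ∀ (f : Fin (suc m) → ℕ) → sum (f ∘ en) ≡ sum (λ x → if S x then f x else 0)
  sum-en f rewrite S0 = cong (f zero +_) (E.sum-en (f ∘ suc))
... | E | false = record
  { size = E.size ; en = suc ∘ E.en ; index = index ; en-∈ = E.en-∈ ; index-en = E.index-en
  ; en-index = en-index ; sum-en = λ f → sum-en f }
  where
  module E = Enum E
  index : Fin (suc m) → Maybe (Fin E.size)
  index zero = nothing
  index (suc x) = E.index x
  en-index : ∀ x i → index x ≡ just i → suc (E.en i) ≡ x
  en-index (suc x) i eq = cong suc (E.en-index x i eq)
  sum-en : ∀ (f : Fin (suc m) → ℕ) → sum (f ∘ suc ∘ E.en) ≡ sum (λ x → if S x then f x else 0)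
  sum-en f rewrite S0 = E.sum-en (f ∘ suc)

bit : Bool → Fin 2
bit true = suc zero
bit false = zero

unbit : Fin 2 → Bool
unbit zero = false
unbit (suc _) = true

unbit-bit : ∀ b → unbit (bit b) ≡ b
unbit-bit true = refl
unbit-bit false = refl

encode : ∀ {m} → Subset m → Fin (2 ^ m)
encode S = funToFin (bit ∘ S)

decode : ∀ {m} → Fin (2 ^ m) → Subset m
decode c = unbit ∘ finToFun c

decode-encode : ∀ {m} (S : Subset m) i → decode (encode S) i ≡ S i
decode-encode S i = trans (cong unbit (finToFun-funToFin (bit ∘ S) i)) (unbit-bit (S i))

encode-injective : ∀ {m} (S S′ : Subset m) → encode S ≡ encode S′ → ∀ i → S i ≡ S′ i
encode-injective S S′ eq i = trans (sym (decode-encode S i)) (trans (cong (λ c → decode c i) eq) (decode-encode S′ i))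

_∈?_ : ∀ {m} (x : Fin m) (L : List (Fin m)) → Dec (x ∈ L)
x ∈? L = Any.any? (x ≟_) L

-- If every colour occurred in `L`, positions would inject `suc m` colours into at most `m` places.
fresh : ∀ {m} (L : List (Fin (suc m))) → length L ≤ m → ∃ λ c → c ∉ L
fresh {m} L len with any? (λ c → ¬? (c ∈? L))
... | yes p = p
... | no ¬p = contradiction (injective⇒≤ {f = Any.index ∘ all} inj) (<⇒≱ (s≤s len))
  where
  all : ∀ c → c ∈ L
  all c with c ∈? L
  ... | yes h = h
  ... | no h = ⊥-elim (¬p (c , h))
  inj : ∀ {c c′} → Any.index (all c) ≡ Any.index (all c′) → c ≡ c′
  inj {c} {c′} eq = trans (lookup-index (all c)) (trans (cong (lookup L) eq) (sym (lookup-index (all c′))))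

-- Walks

module _ {G : Graph} where
  private V = Fin (n G)

  walk-mono : ∀ {P Q : V → Set} {k l x y} → (∀ z → P z → Q z) → k ≤ l → Walk G P k x y → Walk G Q l x y
  walk-mono f _ (here p) = here (f _ p)
  walk-mono f (s≤s k≤l) (step p a w) = step (f _ p) a (walk-mono f k≤l w)

  walk-start : ∀ {P : V → Set} {k x y} → Walk G P k x y → P x
  walk-start (here p) = p
  walk-start (step p _ _) = p

  walk-end : ∀ {P : V → Set} {k x y} → Walk G P k x y → P y
  walk-end (here p) = p
  walk-end (step _ _ w) = walk-end w

  walk-++ : ∀ {P : V → Set} {k l x y z} → Walk G P k x y → Walk G P l y z → Walk G P (k + l) x z
  walk-++ {k = k} (here _) w = walk-mono (λ _ p → p) (m≤n+m _ k) w
  walk-++ (step p a w) w′ = step p a (walk-++ w w′)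

  walk-snoc : ∀ {P : V → Set} {k x y z} → Walk G P k x y → adj G y z ≡ true → P z → Walk G P (suc k) x z
  walk-snoc {P} {k} {x} {z = z} w a p =
    subst (λ l → Walk G P l x z) (+-comm k 1) (walk-++ w (step (walk-end w) a (here p)))

  walk-reverse : ∀ {P : V → Set} {k x y} → Walk G P k x y → Walk G P k y x
  walk-reverse (here p) = here p
  walk-reverse {x = x} (step {y = y} p a w) = walk-snoc (walk-reverse w) (trans (adj-sym G y x) a) p

  walk? : ∀ {P : V → Set} → (∀ x → Dec (P x)) → ∀ k x y → Dec (Walk G P k x y)
  walk? {P} P? zero x y = map′ (λ { (refl , p) → here p }) (λ { (here p) → refl , p }) ((x ≟ y) ×-dec P? x)
  walk? {P} P? (suc k) x y =
    map′ (λ { (inj₁ (refl , p)) → here p ; (inj₂ (p , z , a , w)) → step p a w })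
         (λ { (here p) → inj₁ (refl , p) ; (step p a w) → inj₂ (p , _ , a , w) })
         (((x ≟ y) ×-dec P? x) ⊎-dec
          (P? x ×-dec any? (λ z → (adj G x z Bool.≟ true) ×-dec walk? P? k z y)))

  walk-avoiding : ∀ {P : V → Set} {k x y} m → Walk G P k x y →
    Walk G (λ z → P z × ¬ z ≡ m) k x y ⊎
    (x ≡ m ⊎ ∃ λ z → Walk G (λ z → P z × ¬ z ≡ m) k x z × adj G z m ≡ true)
  walk-avoiding {x = x} m w with x ≟ m
  walk-avoiding m w | yes eq = inj₂ (inj₁ eq)
  walk-avoiding m (here p) | no x≢m = inj₁ (here (p , x≢m))
  walk-avoiding m (step p a w) | no x≢m with walk-avoiding m w
  ... | inj₁ w′ = inj₁ (step (p , x≢m) a w′)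
  ... | inj₂ (inj₁ refl) = inj₂ (inj₂ (_ , here (p , x≢m) , a))
  ... | inj₂ (inj₂ (z , w′ , a′)) = inj₂ (inj₂ (z , step (p , x≢m) a w′ , a′))

  -- Passing from a walk to its set of vertices, any two of which are joined inside that set by a
  -- walk of the same bound, avoids all bookkeeping of positions and subwalks.
  walk-support : ∀ {P : V → Set} {k x y} → Walk G P k x y →
    ∃ λ L → length L ≤ suc k × x ∈ L × y ∈ L × (∀ z → z ∈ L → P z) ×
            (∀ z z′ → z ∈ L → z′ ∈ L → Walk G (_∈ L) k z z′)
  walk-support {P} {k} {x} (here p) =
    x ∷ [] , s≤s z≤n , here refl , here refl , (λ { _ (here refl) → p }) ,
    λ { _ _ (here refl) (here refl) → here (here refl) }
  walk-support {P} {suc k} {x} (step {y = y} p a w) with walk-support w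
  ... | L , len , y∈ , end∈ , inP , conn =
    x ∷ L , s≤s len , here refl , there end∈ ,
    (λ { _ (here refl) → p ; z (there z∈) → inP z z∈ }) , conn′
    where
    from-x : ∀ z → z ∈ L → Walk G (_∈ (x ∷ L)) (suc k) x z
    from-x z z∈ = step (here refl) a (walk-mono (λ _ → there) ≤-refl (conn y z y∈ z∈))
    conn′ : ∀ z z′ → z ∈ (x ∷ L) → z′ ∈ (x ∷ L) → Walk G (_∈ (x ∷ L)) (suc k) z z′
    conn′ _ _ (here refl) (here refl) = here (here refl)
    conn′ _ z′ (here refl) (there z′∈) = from-x z′ z′∈
    conn′ z _ (there z∈) (here refl) = walk-reverse (from-x z z∈)
    conn′ z z′ (there z∈) (there z′∈) = walk-mono (λ _ → there) (n≤1+n k) (conn z z′ z∈ z′∈)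

-- Density of minors whose vertex set is presented as a subset of V(G)

Sparse : Graph → ℕ → ℕ → Set
Sparse G r c = ∀ H → ShallowMinor r H G → degreeSum H ≤ c * n H

-- Vertices of the minor are named by their centres in `G`, so that it can be extended or restricted
-- without reindexing.
record Branching (G : Graph) (r : ℕ) (T : Subset (n G)) : Set where
  field
    σ : Fin (n G) → Maybe (Fin (n G))
    σ-centre : ∀ t → T t ≡ true → σ t ≡ just t
    σ-branch : ∀ x t → σ x ≡ just t → T t ≡ true × Walk G (λ y → σ y ≡ just t) r t x

record Contracted {G r T} (B : Branching G r T) : Set where
  open Branching B
  field
    E : Fin (n G) → Fin (n G) → Bool
    E-sym : ∀ u v → E u v ≡ E v u
    E-irr : ∀ v → E v v ≡ false
    E-edge : ∀ u v → E u v ≡ true →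
             T u ≡ true × ∃ λ x → ∃ λ y → σ x ≡ just u × σ y ≡ just v × adj G x y ≡ true

-- Reindexing by `enum T` yields an actual shallow minor. Since `E` joins only members of `T`,
-- restricting both sums to the enumeration loses no edge.
contracted-sparse : ∀ {G r c T} → Sparse G r c → {B : Branching G r T} (M : Contracted B) →
                    sum (λ u → count (Contracted.E M u)) ≤ c * count T
contracted-sparse {G} {r} {c} {T} sp {B} M =
  subst₂ _≤_ (trans (degreeSum-sum H) degrees) (cong (c *_) size≡count) (sp H minor)
  where
  open Branching B
  open Contracted M
  open Enum (enum T)
  H : Graph
  H = record { n = size ; adj = λ i j → E (en i) (en j)
             ; adj-sym = λ i j → E-sym (en i) (en j) ; adj-irr = λ i → E-irr (en i) }
  E-∈ : ∀ u v → E u v ≡ true → T u ≡ true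
  E-∈ u v e = proj₁ (E-edge u v e)
  σ′ : Fin (n G) → Maybe (Fin size)
  σ′ x = σ x >>= index
  σ′-just : ∀ x v → σ x ≡ just (en v) → σ′ x ≡ just v
  σ′-just x v eq rewrite eq = index-en v
  radius′ : ∀ v x → σ′ x ≡ just v → Walk G (λ y → σ′ y ≡ just v) r (en v) x
  radius′ v x eq with σ x in eqσ
  ... | just t with en-index t v eq
  ... | refl = walk-mono (λ y → σ′-just y v) ≤-refl (proj₂ (σ-branch x t eqσ))
  edges′ : ∀ u v → E (en u) (en v) ≡ true →
           ∃ λ x → ∃ λ y → σ′ x ≡ just u × σ′ y ≡ just v × adj G x y ≡ true
  edges′ u v e with E-edge _ _ e
  ... | _ , x , y , p , q , a = x , y , σ′-just x u p , σ′-just y v q , a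
  minor : ShallowMinor r H G
  minor = record { σ = σ′ ; center = en ; center-in = λ v → σ′-just (en v) v (σ-centre (en v) (en-∈ v))
                 ; radius = radius′ ; edges = edges′ }
  restrict : ∀ (f : Fin (n G) → ℕ) → (∀ x → T x ≡ false → f x ≡ 0) → sum (f ∘ en) ≡ sum f
  restrict f zeros = trans (sum-en f) (sum-cong-≗ lemma)
    where
    lemma : ∀ x → (if T x then f x else 0) ≡ f x
    lemma x with T x in eq
    ... | true = refl
    ... | false = sym (zeros x eq)
  E-out : ∀ u v → T u ≡ false → E u v ≡ false
  E-out u v eq = ¬true⇒false (λ e → true≢false (E-∈ u v e) eq)
  degrees : sum (λ i → sum (λ j → ι (E (en i) (en j)))) ≡ sum (λ u → count (E u))
  degrees = trans
    (sum-cong-≗ (λ i → restrict (λ v → ι (E (en i) v))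
      (λ v eq → cong ι (trans (E-sym (en i) v) (E-out v (en i) eq)))))
    (restrict (λ u → count (E u)) (λ u eq → sum-zero (λ v → cong ι (E-out u v eq))))

-- Discarding the branch sets of centres outside `S` leaves a minor of the same depth.
induced-sparse : ∀ {G r c T} → Sparse G r c → {B : Branching G r T} (M : Contracted B) → ∀ S →
  sum (λ v → if S v then count (λ u → S u ∧ Contracted.E M v u) else 0) ≤ c * count S
induced-sparse {G} {r} {c} {T} sparse {B} M S = begin
  sum (λ v → if S v then count (λ u → S u ∧ E v u) else 0) ≡⟨ sum-cong-≗ inside ⟩
  sum (λ v → count (E↾ v))                                  ≤⟨ contracted-sparse {c = c} sparse M↾ ⟩
  c * count (λ t → T t ∧ S t)                               ≤⟨ *-monoʳ-≤ c (count-mono {S′ = S} (λ t h → proj₂ (∧-true⁻ (T t) h))) ⟩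
  c * count S                                               ∎
  where
  open ≤-Reasoning
  open Branching B
  open Contracted M
  E↾ : Fin (n G) → Fin (n G) → Bool
  E↾ u v = S u ∧ (S v ∧ E u v)
  inside : ∀ v → (if S v then count (λ u → S u ∧ E v u) else 0) ≡ count (E↾ v)
  inside v with S v
  ... | true = refl
  ... | false = sym (sum-replicate-zero (n G))
  restrict : Fin (n G) → Maybe (Fin (n G))
  restrict t = if S t then just t else nothing
  restrict-just : ∀ {x t} → S t ≡ true → σ x ≡ just t → (σ x >>= restrict) ≡ just t
  restrict-just St eq rewrite eq | St = refl
  branch : ∀ x t → (σ x >>= restrict) ≡ just t →
           T t ∧ S t ≡ true × Walk G (λ y → (σ y >>= restrict) ≡ just t) r t x
  branch x t eq with σ x in eqσ
  ... | just t′ with S t′ in St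
  branch x t refl | just .t | true =
    ∧-true (proj₁ (σ-branch x t eqσ)) St , walk-mono (λ _ → restrict-just St) ≤-refl (proj₂ (σ-branch x t eqσ))
  B↾ : Branching G r (λ t → T t ∧ S t)
  B↾ = record
    { σ = λ x → σ x >>= restrict
    ; σ-centre = λ t h → restrict-just (proj₂ (∧-true⁻ (T t) h)) (σ-centre t (proj₁ (∧-true⁻ (T t) h)))
    ; σ-branch = branch }
  E↾⁻ : ∀ u v → E↾ u v ≡ true → S u ≡ true × S v ≡ true × E u v ≡ true
  E↾⁻ u v e = let p , q = ∧-true⁻ (S u) e in p , ∧-true⁻ (S v) q
  symm : ∀ u v → E↾ u v ≡ true → E↾ v u ≡ true
  symm u v e = let p , q , e′ = E↾⁻ u v e in ∧-true q (∧-true p (trans (E-sym v u) e′))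
  M↾ : Contracted B↾
  M↾ = record
    { E = E↾
    ; E-sym = λ u v → bool-ext (symm u v) (symm v u)
    ; E-irr = λ v → ¬true⇒false (λ e → true≢false (proj₂ (proj₂ (E↾⁻ v v e))) (E-irr v))
    ; E-edge = λ u v e → let Su , Sv , e′ = E↾⁻ u v e ; Tu , x , y , p , q , a = E-edge u v e′
                         in ∧-true Tu Su , x , y , restrict-just Su p , restrict-just Sv q , a }

singletons : ∀ {G r} (S : Subset (n G)) → Branching G r S
singletons {G} {r} S = record { σ = σ ; σ-centre = λ t → σ-just ; σ-branch = branch }
  where
  σ : Fin (n G) → Maybe (Fin (n G))
  σ x = if S x then just x else nothing
  σ-just : ∀ {x} → S x ≡ true → σ x ≡ just x
  σ-just Sx rewrite Sx = refl
  branch : ∀ x t → σ x ≡ just t → S t ≡ true × Walk G (λ y → σ y ≡ just t) r t x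
  branch x t eq with S x in Sx
  branch x .x refl | true = Sx , here (σ-just Sx)

-- Orderings and greedy colourings

-- Ranks are handed out from the top: `below v` is the set that remained when `v` was picked, and
-- `v` has the largest rank in it.
record Ranking {m} (Good : Subset m → Fin m → Set) (k : ℕ) (S : Subset m) : Set where
  field
    rank : Fin m → ℕ
    rank-< : ∀ u → S u ≡ true → rank u < k
    rank-injective : ∀ u v → S u ≡ true → S v ≡ true → rank u ≡ rank v → u ≡ v
    below : Fin m → Subset m
    below-good : ∀ v → S v ≡ true → Good (below v) v
    below-complete : ∀ u v → S u ≡ true → S v ≡ true → rank u ≤ rank v → below v u ≡ true

ranking : ∀ {m} {Good : Subset m → Fin m → Set} →
          (∀ S v → S v ≡ true → ∃ λ w → S w ≡ true × Good S w) →
          ∀ k S → count S ≤ k → Ranking Good k S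
ranking pick k S le with any? (λ v → S v Bool.≟ true)
... | no ¬p = record
  { rank = λ _ → 0 ; rank-< = λ u Su → ⊥-elim (¬p (u , Su)) ; rank-injective = λ u _ Su → ⊥-elim (¬p (u , Su))
  ; below = λ _ → S ; below-good = λ u Su → ⊥-elim (¬p (u , Su)) ; below-complete = λ u _ Su → ⊥-elim (¬p (u , Su)) }
ranking pick zero S le | yes (v₀ , Sv₀) = contradiction (≤-trans (count≥1 S v₀ Sv₀) le) λ ()
ranking {m} {Good} pick (suc k) S le | yes (v₀ , Sv₀) with pick S v₀ Sv₀
... | v , Sv , good = record
  { rank = rank ; rank-< = rank-< ; rank-injective = rank-injective
  ; below = below ; below-good = below-good ; below-complete = below-complete }
  where
  S′ = S ─ v
  module R = Ranking (ranking {Good = Good} pick k S′ (s≤s⁻¹ (≤-trans (count-─ S v Sv) le)))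
  rank : Fin m → ℕ
  rank u with u ≟ v
  ... | yes _ = k
  ... | no _ = R.rank u
  rank-< : ∀ u → S u ≡ true → rank u < suc k
  rank-< u Su with u ≟ v
  ... | yes _ = ≤-refl
  ... | no u≢v = m≤n⇒m≤1+n (R.rank-< u (─-true S Su u≢v))
  rank-injective : ∀ u w → S u ≡ true → S w ≡ true → rank u ≡ rank w → u ≡ w
  rank-injective u w Su Sw eq with u ≟ v | w ≟ v
  ... | yes p | yes q = trans p (sym q)
  ... | yes p | no q = contradiction (sym eq) (<⇒≢ (R.rank-< w (─-true S Sw q)))
  ... | no p | yes q = contradiction eq (<⇒≢ (R.rank-< u (─-true S Su p)))
  ... | no p | no q = R.rank-injective u w (─-true S Su p) (─-true S Sw q) eq
  below : Fin m → Subset m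
  below u with u ≟ v
  ... | yes _ = S
  ... | no _ = R.below u
  below-good : ∀ u → S u ≡ true → Good (below u) u
  below-good u Su with u ≟ v
  ... | yes refl = good
  ... | no u≢v = R.below-good u (─-true S Su u≢v)
  below-complete : ∀ u w → S u ≡ true → S w ≡ true → rank u ≤ rank w → below w u ≡ true
  below-complete u w Su Sw le with u ≟ v | w ≟ v
  ... | _ | yes q = Su
  ... | yes p | no q = contradiction le (<⇒≱ (R.rank-< w (─-true S Sw q)))
  ... | no p | no q = R.below-complete u w (─-true S Su p) (─-true S Sw q) le

full : ∀ {m} → Subset m
full _ = true

-- Colours are assigned in increasing rank. Vertices of equal rank are treated at once, as only
-- pairs of different rank are constrained; the sum of all ranks bounds each of them.
greedy-colouring : ∀ {m M} (rank : Fin m → ℕ) (N : Fin m → List (Fin m)) → (∀ v → length (N v) ≤ M) →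
  ∃ λ (χ : Fin m → Fin (suc M)) → ∀ v u → u ∈ N v → rank u < rank v → ¬ χ u ≡ χ v
greedy-colouring {m} {M} rank N len with go (suc (sum rank))
  where
  go : ∀ k → ∃ λ (χ : Fin m → Fin (suc M)) → ∀ v u → rank v < k → u ∈ N v → rank u < rank v → ¬ χ u ≡ χ v
  go zero = (λ _ → zero) , λ _ _ ()
  go (suc k) with go k
  ... | χ , proper = χ′ , proper′
    where
    new : ∀ v → ∃ λ c → c ∉ map χ (N v)
    new v = fresh (map χ (N v)) (≤-trans (≤-reflexive (length-map χ (N v))) (len v))
    χ′ : Fin m → Fin (suc M)
    χ′ v with rank v ℕ.≟ k
    ... | yes _ = proj₁ (new v)
    ... | no _ = χ v
    proper′ : ∀ v u → rank v < suc k → u ∈ N v → rank u < rank v → ¬ χ′ u ≡ χ′ v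
    proper′ v u v< u∈ u<v eq with rank v ℕ.≟ k | rank u ℕ.≟ k
    ... | yes refl | yes q = <⇒≢ u<v q
    ... | no p | yes refl = <⇒≱ u<v (s≤s⁻¹ v<)
    ... | yes p | no q = proj₂ (new v) (subst (_∈ map χ (N v)) eq (∈-map⁺ χ u∈))
    ... | no p | no q = proper v u (≤∧≢⇒< (s≤s⁻¹ v<) p) u∈ u<v eq
... | χ , proper = χ , λ v u → proper v u (s≤s (≤-sum rank v))

-- If `f` exceeded `K` throughout `S`, so would its average; the member `v` makes the inequality of
-- the sums strict.
average : ∀ {m} (S : Subset m) (f : Fin m → ℕ) K → sum (λ v → if S v then f v else 0) ≤ K * count S →
          ∀ v → S v ≡ true → ∃ λ w → S w ≡ true × f w ≤ K
average S f K le v Sv with any? (λ w → (S w Bool.≟ true) ×-dec (f w ≤? K))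
... | yes p = p
... | no ¬p = contradiction le (<⇒≱ (≤-trans (≤-reflexive (cong suc (sym (sum-*ˡ K (ι ∘ S))))) (sum-mono-< {f = λ w → K * ι (S w)} weak v strict)))
  where
  weak : ∀ w → K * ι (S w) ≤ (if S w then f w else 0)
  weak w with S w in eq
  ... | true = ≤-trans (≤-reflexive (*-identityʳ K)) (<⇒≤ (≰⇒> (λ le → ¬p (w , eq , le))))
  ... | false = ≤-reflexive (*-zeroʳ K)
  strict : K * ι (S v) < (if S v then f v else 0)
  strict rewrite Sv = ≤-trans (s≤s (≤-reflexive (*-identityʳ K))) (≰⇒> (λ le → ¬p (v , Sv , le)))

NeighboursWithin : ∀ {m} → ℕ → (Fin m → Fin m → Bool) → Subset m → Fin m → Set
NeighboursWithin c E S v = ∃ λ L → length L ≤ c × (∀ u → S u ≡ true → E v u ≡ true → u ∈ L)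

ranked-colouring : ∀ {m} c (E : Fin m → Fin m → Bool) → (∀ u v → E u v ≡ E v u) → (∀ v → E v v ≡ false) →
  Ranking (NeighboursWithin c E) m full →
  ∃ λ (χ : Fin m → Fin (suc c)) → ∀ u v → E u v ≡ true → ¬ χ u ≡ χ v
ranked-colouring {m} c E E-sym E-irr R = proj₁ coloured , proper
  where
  open Ranking R
  coloured : ∃ λ (χ : Fin m → Fin (suc c)) → ∀ v u → u ∈ proj₁ (below-good v refl) → rank u < rank v → ¬ χ u ≡ χ v
  coloured = greedy-colouring rank (λ v → proj₁ (below-good v refl)) (λ v → proj₁ (proj₂ (below-good v refl)))
  ordered : ∀ u v → rank u < rank v → E v u ≡ true → ¬ proj₁ coloured u ≡ proj₁ coloured v
  ordered u v lt e = proj₂ coloured v u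
    (proj₂ (proj₂ (below-good v refl)) u (below-complete u v refl refl (<⇒≤ lt)) e) lt
  proper : ∀ u v → E u v ≡ true → ¬ proj₁ coloured u ≡ proj₁ coloured v
  proper u v e eq with <-cmp (rank u) (rank v)
  ... | tri< lt _ _ = ordered u v lt (trans (E-sym v u) e) eq
  ... | tri> _ _ gt = ordered v u gt e (sym eq)
  ... | tri≈ _ same _ with rank-injective u v refl refl same
  ... | refl = true≢false e (E-irr u)

-- By averaging, every non-empty `S` has a member with at most `c` neighbours in `S`. Ranked above
-- the rest of `S`, it sees at most `c` forbidden colours.
degenerate-colouring : ∀ {m} c (E : Fin m → Fin m → Bool) → (∀ u v → E u v ≡ E v u) → (∀ v → E v v ≡ false) →
  (∀ S → sum (λ v → if S v then count (λ u → S u ∧ E v u) else 0) ≤ c * count S) →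
  ∃ λ (χ : Fin m → Fin (suc c)) → ∀ u v → E u v ≡ true → ¬ χ u ≡ χ v
degenerate-colouring {m} c E E-sym E-irr sparse =
  ranked-colouring c E E-sym E-irr (ranking pick m full (count≤n full))
  where
  pick : ∀ S v → S v ≡ true → ∃ λ w → S w ≡ true × NeighboursWithin c E S w
  pick S v Sv with average S (λ v → count (λ u → S u ∧ E v u)) c (sparse S) v Sv
  ... | w , Sw , le = w , Sw , members (λ u → S u ∧ E w u) ,
    ≤-trans (≤-reflexive (length-members (λ u → S u ∧ E w u))) le ,
    λ u Su e → ∈-members (λ u → S u ∧ E w u) (∧-true Su e)

count-∪-list : ∀ {m} (L : List (Fin m)) (S S′ : Subset m) →
               (∀ i → S′ i ≡ true → S i ≡ true ⊎ i ∈ L) → count S′ ≤ count S + length L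
count-∪-list [] S S′ h = ≤-trans (count-mono {S = S′} {S} (λ i p → [ id , (λ ()) ]′ (h i p))) (m≤m+n _ 0)
count-∪-list {m} (x ∷ L) S S′ h = begin
  count S′                                              ≤⟨ sum-mono-≤ split ⟩
  sum (λ i → ι ((S′ ─ x) i) + (if ⌊ i ≟ x ⌋ then 1 else 0)) ≡⟨ ∑-distrib-+ (ι ∘ (S′ ─ x)) _ ⟩
  count (S′ ─ x) + sum (λ i → if ⌊ i ≟ x ⌋ then 1 else 0) ≡⟨ cong (count (S′ ─ x) +_) (sum-point (λ _ → 1) x) ⟩
  count (S′ ─ x) + 1                                    ≡⟨ +-comm _ 1 ⟩
  suc (count (S′ ─ x))                                  ≤⟨ s≤s (count-∪-list L S (S′ ─ x) h′) ⟩
  suc (count S + length L)                              ≡⟨ +-suc _ _ ⟨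
  count S + suc (length L)                              ∎
  where
  open ≤-Reasoning
  split : ∀ i → ι (S′ i) ≤ ι ((S′ ─ x) i) + (if ⌊ i ≟ x ⌋ then 1 else 0)
  split i with S′ i | i ≟ x
  ... | true | yes _ = ≤-refl
  ... | true | no _ = ≤-refl
  ... | false | _ = z≤n
  h′ : ∀ i → (S′ ─ x) i ≡ true → S i ≡ true ⊎ i ∈ L
  h′ i p with ─-true⁻ S′ p
  ... | S′i , i≢x with h i S′i
  ... | inj₁ Si = inj₁ Si
  ... | inj₂ (here eq) = ⊥-elim (i≢x eq)
  ... | inj₂ (there i∈) = inj₂ i∈

-- Linking vertices of S until the balls around them overlap only along links

module Exits (G : Graph) (r c : ℕ) (sparse : Sparse G (r + r) c) where
  V = Fin (n G)
  R = r + r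

  Free : Subset (n G) → V → V → Set
  Free T v x = x ≡ v ⊎ T x ≡ false

  free? : ∀ T v x → Dec (Free T v x)
  free? T v x = (x ≟ v) ⊎-dec (T x Bool.≟ false)

  -- These are the vertices where a short walk from `v` can first enter the rest of `T`; within
  -- distance `r` they separate `v` from it.
  Exit : Subset (n G) → V → V → Set
  Exit T v t = T t ≡ true × ¬ t ≡ v × ∃ λ y → Walk G (Free T v) r v y × adj G y t ≡ true

  exit? : ∀ T v t → Dec (Exit T v t)
  exit? T v t = (T t Bool.≟ true) ×-dec (¬? (t ≟ v) ×-dec
    any? (λ y → walk? (free? T v) r v y ×-dec (adj G y t Bool.≟ true)))

  exits : Subset (n G) → V → Subset (n G)
  exits T v t = ⌊ exit? T v t ⌋

  -- The first vertex of `T` other than `v` on the walk is an exit; returns to `v` merely prolong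
  -- the free prefix. At least one step precedes it, whence the bound `k` for the rest.
  exits-hit : ∀ {T v} {P : V → Set} {k u} → T u ≡ true → ¬ u ≡ v → Walk G P (suc k) v u → suc k ≤ r →
              ∃ λ z → exits T v z ≡ true × Walk G P k z u
  exits-hit {T} {v} {P} {k} {u} Tu u≢v w le = go {0} (here (inj₁ refl)) w ≤-refl le
    where
    go : ∀ {j m x} → Walk G (Free T v) j v x → Walk G P m x u → m ≤ suc k → j + m ≤ r →
         ∃ λ z → exits T v z ≡ true × Walk G P k z u
    go pre (here p) _ _ with walk-end pre
    ... | inj₁ eq = ⊥-elim (u≢v eq)
    ... | inj₂ eq = ⊥-elim (true≢false Tu eq)
    go {j} {suc m} {x} pre (step {y = x′} p a w) m≤ le with T x′ in Tx′ | x′ ≟ v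
    ... | true | no x′≢v = x′ , ⌊⌋-true (exit? T v x′) (Tx′ , x′≢v , x , walk-mono (λ _ q → q) (≤-trans (m≤m+n j _) le) pre , a)
                         , walk-mono (λ _ q → q) (s≤s⁻¹ m≤) w
    ... | true | yes eq = go {suc j} (walk-snoc pre a (inj₁ eq)) w (≤-trans (n≤1+n _) m≤) (≤-trans (≤-reflexive (sym (+-suc j m))) le)
    ... | false | _ = go {suc j} (walk-snoc pre a (inj₂ Tx′)) w (≤-trans (n≤1+n _) m≤) (≤-trans (≤-reflexive (sym (+-suc j m))) le)

  module _ (S : Subset (n G)) where

    record State : Set where
      field
        B : Branching G R S
        M : Contracted B
      open Branching B public
      open Contracted M public
      T : Subset (n G)
      T x = is-just (σ x)
      edges : ℕ
      edges = sum (λ u → count (E u))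
      field
        -- A linking walk has at most `suc R` vertices. `edges` counts ordered pairs, so each link
        -- raises it by at least one.
        T-size : count T ≤ count S + suc R * edges

      S⊆T : ∀ {v} → S v ≡ true → T v ≡ true
      S⊆T {v} Sv rewrite σ-centre v Sv = refl

      edges-≤ : edges ≤ c * count S
      edges-≤ = contracted-sparse {c = c} sparse M

    open State

    Link : State → V → V → V → Set
    Link s v v′ y = S v ≡ true × S v′ ≡ true × ¬ v ≡ v′ × E s v v′ ≡ false ×
                    Walk G (Free (T s) v) R v y × adj G y v′ ≡ true

    Linkable : State → Set
    Linkable s = ∃ λ v → ∃ λ v′ → ∃ λ y → Link s v v′ y

    linkable? : ∀ s → Dec (Linkable s)
    linkable? s = any? λ v → any? λ v′ → any? λ y →
      (S v Bool.≟ true) ×-dec (S v′ Bool.≟ true) ×-dec ¬? (v ≟ v′) ×-dec (E s v v′ Bool.≟ false) ×-dec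
      walk? (free? (T s) v) R v y ×-dec (adj G y v′ Bool.≟ true)

    initial : State
    initial = record
      { B = singletons S
      ; M = record { E = λ _ _ → false ; E-sym = λ _ _ → refl ; E-irr = λ _ → refl ; E-edge = λ _ _ () }
      ; T-size = ≤-trans (count-mono ⊆S) (m≤m+n _ _) }
      where
      ⊆S : ∀ i → is-just (if S i then just i else nothing) ≡ true → S i ≡ true
      ⊆S i eq with S i
      ... | true = refl

    -- The interior of the connecting walk joins the branch set of v.
    link : ∀ s → Linkable s → ∃ λ (s′ : State) → edges s < edges s′
    link s (v , v′ , y , Sv , Sv′ , v≢v′ , Evv′ , w , a) with walk-support w
    ... | L , len , v∈ , y∈ , free , conn = record
      { B = record { σ = σ′ ; σ-centre = λ t St → keep (σ-centre s t St) ; σ-branch = branch′ }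
      ; M = record { E = λ u w → ⌊ E′? u w ⌋
                   ; E-sym = λ u w → bool-ext (sym′ u w) (sym′ w u)
                   ; E-irr = λ u → ⌊⌋-false (E′? u u) irr′
                   ; E-edge = λ u w e → edge′ u w (⌊⌋-true⁻ (E′? u w) e) }
      ; T-size = size′ } , more
      where
      σ′ : V → Maybe V
      σ′ x = if ⌊ x ∈? L ⌋ then just v else σ s x
      σ′-L : ∀ {x} → x ∈ L → σ′ x ≡ just v
      σ′-L {x} x∈ rewrite ⌊⌋-true (x ∈? L) x∈ = refl
      -- The walk is free, so the only vertex on it that was already assigned is `v`, and `v` keeps
      -- its value.
      keep : ∀ {x u} → σ s x ≡ just u → σ′ x ≡ just u
      keep {x} {u} eq with x ∈? L
      ... | no _ = eq
      ... | yes x∈ with free x x∈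
      ... | inj₁ refl = trans (sym (σ-centre s v Sv)) eq
      ... | inj₂ out rewrite eq = contradiction out λ ()
      branch′ : ∀ x t → σ′ x ≡ just t → S t ≡ true × Walk G (λ z → σ′ z ≡ just t) R t x
      branch′ x t eq with x ∈? L
      branch′ x .v refl | yes x∈ = Sv , walk-mono (λ _ → σ′-L) ≤-refl (conn v x v∈ x∈)
      branch′ x t eq | no _ with σ-branch s x t eq
      ... | St , wt = St , walk-mono (λ _ → keep) ≤-refl wt
      E′ : V → V → Set
      E′ u w = E s u w ≡ true ⊎ (u ≡ v × w ≡ v′) ⊎ (u ≡ v′ × w ≡ v)
      E′? : ∀ u w → Dec (E′ u w)
      E′? u w = (E s u w Bool.≟ true) ⊎-dec (((u ≟ v) ×-dec (w ≟ v′)) ⊎-dec ((u ≟ v′) ×-dec (w ≟ v)))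
      E′-sym : ∀ {u w} → E′ u w → E′ w u
      E′-sym {u} {w} (inj₁ e) = inj₁ (trans (E-sym s w u) e)
      E′-sym (inj₂ (inj₁ (p , q))) = inj₂ (inj₂ (q , p))
      E′-sym (inj₂ (inj₂ (p , q))) = inj₂ (inj₁ (q , p))
      sym′ : ∀ u w → ⌊ E′? u w ⌋ ≡ true → ⌊ E′? w u ⌋ ≡ true
      sym′ u w e = ⌊⌋-true (E′? w u) (E′-sym (⌊⌋-true⁻ (E′? u w) e))
      irr′ : ∀ {u} → ¬ E′ u u
      irr′ {u} (inj₁ e) = true≢false e (E-irr s u)
      irr′ (inj₂ (inj₁ (p , q))) = v≢v′ (trans (sym p) q)
      irr′ (inj₂ (inj₂ (p , q))) = v≢v′ (trans (sym q) p)
      edge′ : ∀ u w → E′ u w → S u ≡ true × ∃ λ x → ∃ λ z → σ′ x ≡ just u × σ′ z ≡ just w × adj G x z ≡ true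
      edge′ u w (inj₁ e) with E-edge s u w e
      ... | Su , x , z , p , q , b = Su , x , z , keep p , keep q , b
      edge′ u w (inj₂ (inj₁ (refl , refl))) = Sv , y , v′ , σ′-L y∈ , keep (σ-centre s v′ Sv′) , a
      edge′ u w (inj₂ (inj₂ (refl , refl))) =
        Sv′ , v′ , y , keep (σ-centre s v′ Sv′) , σ′-L y∈ , trans (adj-sym G v′ y) a
      more : sum (λ u → count (E s u)) < sum (λ u → count (λ w → ⌊ E′? u w ⌋))
      more = sum-mono-< (λ u → count-mono {S = E s u} (grows u)) v
               (count-mono-< {S = E s v} (grows v) v′ Evv′ (⌊⌋-true (E′? v v′) (inj₂ (inj₁ (refl , refl)))))
        where
        grows : ∀ u w → E s u w ≡ true → ⌊ E′? u w ⌋ ≡ true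
        grows u w e = ⌊⌋-true (E′? u w) (inj₁ e)
      T⊆ : ∀ x → is-just (σ′ x) ≡ true → T s x ≡ true ⊎ x ∈ L
      T⊆ x e with x ∈? L
      ... | yes x∈ = inj₂ x∈
      ... | no _ = inj₁ e
      size′ : count (is-just ∘ σ′) ≤ count S + suc R * sum (λ u → count (λ w → ⌊ E′? u w ⌋))
      size′ = begin
        count (is-just ∘ σ′)                        ≤⟨ count-∪-list L (T s) (is-just ∘ σ′) T⊆ ⟩
        count (T s) + length L                      ≤⟨ +-mono-≤ (T-size s) len ⟩
        count S + suc R * edges s + suc R           ≡⟨ +-assoc (count S) _ _ ⟩
        count S + (suc R * edges s + suc R)         ≡⟨ cong (count S +_) (trans (+-comm _ (suc R)) (sym (*-suc (suc R) (edges s)))) ⟩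
        count S + suc R * suc (edges s)             ≤⟨ +-monoʳ-≤ (count S) (*-monoʳ-≤ (suc R) more) ⟩
        count S + suc R * sum (λ u → count (λ w → ⌊ E′? u w ⌋)) ∎
        where open ≤-Reasoning

    -- Every link raises `edges`, which sparsity caps at `c * count S`; this bounds the fuel.
    saturated : ∃ λ s → ¬ Linkable s
    saturated = go (suc (c * count S)) initial (m≤n+m (suc (c * count S)) (edges initial))
      where
      go : ∀ fuel s → c * count S < edges s + fuel → ∃ λ s → ¬ Linkable s
      go zero s lt = contradiction (edges-≤ s) (<⇒≱ (subst (c * count S <_) (+-identityʳ _) lt))
      go (suc fuel) s lt with linkable? s
      ... | no ¬l = s , ¬l
      ... | yes l with link s l
      ... | s′ , grows = go fuel s′ (≤-trans lt (≤-trans (≤-reflexive (+-suc _ fuel)) (+-monoˡ-≤ fuel grows)))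

-- One factor `suc c` for the colours of the link graph, one factor `c` for the density of the
-- contracted graph on `T`, and the last factor bounds `count T` in terms of `count S`.
exit-bound : ℕ → ℕ → ℕ
exit-bound r c = suc c * (c * suc (suc (r + r) * c))

module FewExits (G : Graph) (r c : ℕ) (sparse : Sparse G (r + r) c) (S : Subset (n G))
                (s : Exits.State G r c sparse S) (unlinkable : ¬ Exits.Linkable G r c sparse S s) where
  open Exits G r c sparse
  open State s

  sparse-r : Sparse G r c
  sparse-r H m = sparse H record
    { σ = m.σ ; center = m.center ; center-in = m.center-in ; edges = m.edges
    ; radius = λ v x eq → walk-mono (λ _ q → q) (m≤m+n r r) (m.radius v x eq) }
    where module m = ShallowMinor m

  abstract
    colourable : ∃ λ (χ : V → Fin (suc c)) → ∀ u v → E u v ≡ true → ¬ χ u ≡ χ v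
    colourable = degenerate-colouring c E E-sym E-irr (induced-sparse {c = c} sparse M)

  χ = proj₁ colourable

  Ball : Fin (suc c) → V → V → Set
  Ball a v x = S v ≡ true × χ v ≡ a × T x ≡ false × Walk G (Free T v) r v x

  ball? : ∀ a v x → Dec (Ball a v x)
  ball? a v x = (S v Bool.≟ true) ×-dec (χ v ≟ a) ×-dec (T x Bool.≟ false) ×-dec walk? (free? T v) r v x

  -- Balls around equally coloured vertices are disjoint, as otherwise these could be linked.
  ball-unique : ∀ a v v′ x → Ball a v x → Ball a v′ x → v ≡ v′
  ball-unique a v v′ x (Sv , χv , Tx , w) (Sv′ , χv′ , _ , w′) with v ≟ v′ | E v v′ Bool.≟ true
  ... | yes eq | _ = eq
  ... | no _ | yes e = ⊥-elim (proj₂ colourable v v′ e (trans χv (sym χv′)))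
  ... | no v≢v′ | no ¬e with walk-avoiding v′ (walk-reverse w′)
  ... | inj₁ w″ = ⊥-elim (proj₂ (walk-end w″) refl)
  ... | inj₂ (inj₁ refl) = ⊥-elim (true≢false (S⊆T Sv′) Tx)
  ... | inj₂ (inj₂ (z , w″ , a′)) = ⊥-elim (unlinkable (v , v′ , z , Sv , Sv′ , v≢v′ , ¬true⇒false ¬e
        , walk-++ w (walk-mono (λ { y (inj₁ eq , ≢) → ⊥-elim (≢ eq) ; y (inj₂ out , _) → inj₂ out }) ≤-refl w″) , a′))

  module Class (a : Fin (suc c)) where
    choose : ∀ x → Bool → Dec (∃ λ v → Ball a v x) → Maybe V
    choose x true _ = just x
    choose x false (yes (v , _)) = just v
    choose x false (no _) = nothing

    -- Every member of `T` is its own centre, and those of colour `a` in `S` also absorb their balls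
    -- outside `T`.
    σₐ : V → Maybe V
    σₐ x = choose x (T x) (any? (λ v → ball? a v x))

    σₐ-T : ∀ {x} → T x ≡ true → σₐ x ≡ just x
    σₐ-T {x} Tx = cong (λ b → choose x b (any? (λ v → ball? a v x))) Tx

    σₐ-ball : ∀ {v x} → Ball a v x → σₐ x ≡ just v
    σₐ-ball {v} {x} b = trans (cong (λ t → choose x t (any? (λ v → ball? a v x))) (proj₁ (proj₂ (proj₂ b)))) (chosen _)
      where
      chosen : ∀ d → choose x false d ≡ just v
      chosen (yes (v′ , b′)) = cong just (ball-unique a v′ v x b′ b)
      chosen (no ¬p) = ⊥-elim (¬p (v , b))

    σₐ-free : ∀ {v x} → S v ≡ true → χ v ≡ a → Walk G (Free T v) r v x → Free T v x → σₐ x ≡ just v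
    σₐ-free Sv χv w (inj₁ refl) = σₐ-T (S⊆T Sv)
    σₐ-free Sv χv w (inj₂ out) = σₐ-ball (Sv , χv , out , w)

    σₐ-branch : ∀ x t → σₐ x ≡ just t → T t ≡ true × Walk G (λ y → σₐ y ≡ just t) r t x
    σₐ-branch x t = go (T x) (any? (λ v → ball? a v x)) refl
      where
      go : ∀ b d → T x ≡ b → choose x b d ≡ just t → T t ≡ true × Walk G (λ y → σₐ y ≡ just t) r t x
      go true _ Tx refl = Tx , here (σₐ-T Tx)
      go false (yes (_ , Sv , χv , _ , w)) _ refl with walk-support w
      ... | L , _ , t∈ , x∈ , free , conn = S⊆T Sv ,
        walk-mono (λ z z∈ → σₐ-free Sv χv (walk-mono free ≤-refl (conn t z t∈ z∈)) (free z z∈)) ≤-refl (conn t x t∈ x∈)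

    Bₐ : Branching G r T
    Bₐ = record { σ = σₐ ; σ-centre = λ t → σₐ-T ; σ-branch = σₐ-branch }

    Arc : V → V → Set
    Arc v t = S v ≡ true × χ v ≡ a × Exit T v t

    arc? : ∀ v t → Dec (Arc v t)
    arc? v t = (S v Bool.≟ true) ×-dec (χ v ≟ a) ×-dec exit? T v t

    Eₐ? : ∀ u w → Dec (Arc u w ⊎ Arc w u)
    Eₐ? u w = arc? u w ⊎-dec arc? w u

    arc-edge : ∀ v t → Arc v t → ∃ λ x → ∃ λ y → σₐ x ≡ just v × σₐ y ≡ just t × adj G x y ≡ true
    arc-edge v t (Sv , χv , Tt , _ , y , w , b) = y , t , σₐ-free Sv χv w (walk-end w) , σₐ-T Tt , b

    Mₐ : Contracted Bₐ
    Mₐ = record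
      { E = λ u w → ⌊ Eₐ? u w ⌋
      ; E-sym = λ u w → bool-ext (λ e → ⌊⌋-true (Eₐ? w u) (swap (⌊⌋-true⁻ (Eₐ? u w) e)))
                                 (λ e → ⌊⌋-true (Eₐ? u w) (swap (⌊⌋-true⁻ (Eₐ? w u) e)))
      ; E-irr = λ u → ⌊⌋-false (Eₐ? u u) [ irr , irr ]′
      ; E-edge = λ u w e → edge u w (⌊⌋-true⁻ (Eₐ? u w) e) }
      where
      irr : ∀ {u} → ¬ Arc u u
      irr (_ , _ , _ , u≢u , _) = u≢u refl
      edge : ∀ u w → Arc u w ⊎ Arc w u →
             T u ≡ true × ∃ λ x → ∃ λ y → σₐ x ≡ just u × σₐ y ≡ just w × adj G x y ≡ true
      edge u w (inj₁ p) = S⊆T (proj₁ p) , arc-edge u w p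
      edge u w (inj₂ p@(_ , _ , Tu , _)) with arc-edge w u p
      ... | x , y , q , q′ , b = Tu , y , x , q′ , q , trans (adj-sym G y x) b

    -- After contracting the balls of colour `a`, the exits of such a `v` are distinct neighbours of
    -- `v` in a minor with vertex set `T`.
    class-sum : sum (λ v → if ⌊ a ≟ χ v ⌋ then (if S v then count (exits T v) else 0) else 0) ≤ c * count T
    class-sum = ≤-trans (sum-mono-≤ bound) (contracted-sparse {c = c} sparse-r Mₐ)
      where
      bound : ∀ v → (if ⌊ a ≟ χ v ⌋ then (if S v then count (exits T v) else 0) else 0) ≤ count (λ w → ⌊ Eₐ? v w ⌋)
      bound v = go (a ≟ χ v) (S v) refl
        where
        go : ∀ (d : Dec (a ≡ χ v)) b → S v ≡ b →
             (if ⌊ d ⌋ then (if b then count (exits T v) else 0) else 0) ≤ count (λ w → ⌊ Eₐ? v w ⌋)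
        go (no _) _ _ = z≤n
        go (yes _) false _ = z≤n
        go (yes eq) true Sv = count-mono {S = exits T v}
          (λ t e → ⌊⌋-true (Eₐ? v t) (inj₁ (Sv , sym eq , ⌊⌋-true⁻ (exit? T v t) e)))

  K : ℕ
  K = exit-bound r c

  few-exits : ∀ v → S v ≡ true → ∃ λ w → S w ≡ true × count (exits T w) ≤ K
  few-exits v Sv = average S (λ w → count (exits T w)) K total v Sv
    where
    open ≤-Reasoning
    f : V → ℕ
    f w = if S w then count (exits T w) else 0
    T-≤ : count T ≤ suc (suc R * c) * count S
    T-≤ = begin
      count T                          ≤⟨ T-size ⟩
      count S + suc R * edges          ≤⟨ +-monoʳ-≤ (count S) (*-monoʳ-≤ (suc R) edges-≤) ⟩
      count S + suc R * (c * count S)  ≡⟨ cong (count S +_) (*-assoc (suc R) c (count S)) ⟨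
      suc (suc R * c) * count S        ∎
    -- Each vertex is charged to the class of its colour; exchanging the sums leaves one `class-sum`
    -- per colour.
    total : sum f ≤ K * count S
    total = begin
      sum f                                                                ≡⟨ sum-cong-≗ (λ w → sym (sum-point (λ _ → f w) (χ w))) ⟩
      sum (λ w → sum {suc c} (λ a → if ⌊ a ≟ χ w ⌋ then f w else 0))              ≡⟨ ∑-comm {n G} {suc c} (λ w a → if ⌊ a ≟ χ w ⌋ then f w else 0) ⟩
      sum {suc c} (λ a → sum (λ w → if ⌊ a ≟ χ w ⌋ then f w else 0))              ≤⟨ sum-mono-≤ {suc c} (λ a → Class.class-sum a) ⟩
      sum {suc c} (λ _ → c * count T)                                      ≡⟨ sum-const (suc c) (c * count T) ⟩
      suc c * (c * count T)                                                ≤⟨ *-monoʳ-≤ (suc c) (*-monoʳ-≤ c T-≤) ⟩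
      suc c * (c * (suc (suc R * c) * count S))                            ≡⟨ cong (suc c *_) (*-assoc c (suc (suc R * c)) (count S)) ⟨
      suc c * (c * suc (suc R * c) * count S)                              ≡⟨ *-assoc (suc c) (c * suc (suc R * c)) (count S) ⟨
      K * count S                                                          ∎

-- Recursing along hitting sets enumerates everything that v weakly reaches within r steps.
Hitting : (G : Graph) → ℕ → ℕ → Subset (n G) → Fin (n G) → Set
Hitting G r K S v = ∃ λ Z → length Z ≤ K × (∀ (P : Subset (n G)) k u → S u ≡ true → ¬ u ≡ v → suc k ≤ r →
  Walk G (λ y → P y ≡ true) (suc k) v u → ∃ λ z → z ∈ Z × Walk G (λ y → P y ≡ true) k z u)

abstract
  hitting : ∀ G r c → Sparse G (r + r) c → ∀ S v → S v ≡ true →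
            ∃ λ w → S w ≡ true × Hitting G r (exit-bound r c) S w
  hitting G r c sparse S v Sv with Exits.saturated G r c sparse S
  ... | s , unlinkable with FewExits.few-exits G r c sparse S s unlinkable v Sv
  ... | w , Sw , few = w , Sw , members (exits T w) , ≤-trans (≤-reflexive (length-members (exits T w))) few ,
    λ P k u Su u≢w le walk → let z , z∈ , rest = exits-hit (S⊆T Su) u≢w walk le in z , ∈-members (exits T w) z∈ , rest
    where
    open Exits G r c sparse
    open State s

-- Centred colourings

record Centred (G : Graph) (r N : ℕ) : Set where
  field
    rank : Fin (n G) → ℕ
    rank-injective : ∀ u v → rank u ≡ rank v → u ≡ v
    χ : Fin (n G) → Fin N
    centred : ∀ k v u → k ≤ r → Walk G (λ x → rank u ≤ rank x) k v u → ¬ u ≡ v → ¬ χ u ≡ χ v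

reach : ∀ {m} → (Fin m → List (Fin m)) → ℕ → Fin m → List (Fin m)
reach Z zero v = v ∷ []
reach Z (suc k) v = v ∷ concatMap (reach Z k) (Z v)

reach-bound : ℕ → ℕ → ℕ
reach-bound K zero = 1
reach-bound K (suc k) = suc (K * reach-bound K k)

length-concatMap : ∀ {A B : Set} (f : A → List B) M → (∀ x → length (f x) ≤ M) → ∀ L → length (concatMap f L) ≤ length L * M
length-concatMap f M le [] = z≤n
length-concatMap f M le (x ∷ L) =
  ≤-trans (≤-reflexive (length-++ (f x))) (+-mono-≤ (le x) (length-concatMap f M le L))

length-reach : ∀ {m} (Z : Fin m → List (Fin m)) K → (∀ v → length (Z v) ≤ K) → ∀ k v → length (reach Z k v) ≤ reach-bound K k
length-reach Z K le zero v = ≤-refl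
length-reach Z K le (suc k) v = s≤s (≤-trans (length-concatMap (reach Z k) (reach-bound K k) (length-reach Z K le k) (Z v))
                                             (*-monoˡ-≤ (reach-bound K k) (le v)))

ranked-centred : ∀ {G r K} → Ranking (Hitting G r K) (n G) full → Centred G r (suc (reach-bound K r))
ranked-centred {G} {r} {K} R = record
  { rank = rank ; rank-injective = λ u v → rank-injective u v refl refl ; χ = proj₁ coloured ; centred = centred }
  where
  open Ranking R
  Z : Fin (n G) → List (Fin (n G))
  Z v = proj₁ (below-good v refl)
  coloured = greedy-colouring rank (reach Z r) (length-reach Z K (λ v → proj₁ (proj₂ (below-good v refl))) r)
  Above : Fin (n G) → Subset (n G)
  Above u x = ⌊ rank u ≤? rank x ⌋
  above : ∀ {u x} → Above u x ≡ true → rank u ≤ rank x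
  above {u} {x} = ⌊⌋-true⁻ (rank u ≤? rank x)
  -- The hitting set of `v` applies because `u` lies in `below v`. The vertex `z` found need not
  -- rank below `v`, but the rest of the walk still stays above `u`, so `u` lies in `below z` and
  -- the argument repeats with a shorter walk.
  weakly-reached : ∀ k l v u → l ≤ r → l ≤ k → Walk G (λ x → Above u x ≡ true) l v u → u ∈ reach Z k v
  weakly-reached zero _ v u _ _ (here _) = here refl
  weakly-reached (suc k) l v u l≤r l≤k w with u ≟ v
  ... | yes eq = here eq
  weakly-reached (suc k) l v .v l≤r l≤k (here _) | no v≢v = ⊥-elim (v≢v refl)
  weakly-reached (suc k) (suc l) v u l≤r (s≤s l≤k) w@(step p _ _) | no u≢v
    with proj₂ (proj₂ (below-good v refl)) (Above u) l u (below-complete u v refl refl (above p)) u≢v l≤r w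
  ... | z , z∈ , w′ = there (∈-concatMap⁺ (reach Z k)
          (Any.map (λ { refl → weakly-reached k l z u (≤-trans (n≤1+n l) l≤r) l≤k w′ }) z∈))
  centred : ∀ k v u → k ≤ r → Walk G (λ x → rank u ≤ rank x) k v u → ¬ u ≡ v → ¬ proj₁ coloured u ≡ proj₁ coloured v
  centred k v u k≤r w u≢v = proj₂ coloured v u
    (weakly-reached r k v u k≤r k≤r (walk-mono (λ x → ⌊⌋-true (rank u ≤? rank x)) ≤-refl w))
    (≤∧≢⇒< (walk-start w) (u≢v ∘ rank-injective u v refl refl))

colours : ℕ → ℕ → ℕ
colours r c = suc (reach-bound (exit-bound r c) r)

abstract
  centred-colouring : ∀ G r c → Sparse G (r + r) c → Centred G r (colours r c)
  centred-colouring G r c sparse = ranked-centred (ranking (hitting G r c sparse) (n G) full (count≤n full))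

-- Universal graphs for few colours

argmin : ∀ {m} (rank : Fin m → ℕ) (L : List (Fin m)) {x} → x ∈ L → ∃ λ y → y ∈ L × (∀ z → z ∈ L → rank y ≤ rank z)
argmin rank (x ∷ []) _ = x , here refl , λ { _ (here refl) → ≤-refl }
argmin rank (x ∷ L@(_ ∷ _)) _ with argmin rank L (here refl)
... | y , y∈ , least with rank x ≤? rank y
... | yes le = x , here refl , λ { _ (here refl) → ≤-refl ; z (there z∈) → ≤-trans le (least z z∈) }
... | no gt = y , there y∈ , λ { _ (here refl) → <⇒≤ (≰⇒> gt) ; z (there z∈) → least z z∈ }

-- Diameter bound for the components of a union of q colour classes.
diam : ℕ → ℕ
diam zero = 0
diam (suc q) = suc (diam q) + suc (diam q)

diam-≤ : ∀ q → diam q ≤ diam (suc q)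
diam-≤ q = ≤-trans (n≤1+n _) (m≤m+n _ _)

-- The component universal for labelled graphs of q colours: a root with its label and
-- the subset of the universal graph for q colours realised below the root.
-- Labels below the root additionally record adjacency to the root.
usize : ℕ → ℕ → ℕ
usize zero a = 0
usize (suc q) a = (a * 2 ^ usize q (a * 2)) * suc (usize q (a * 2))

module _ {q a : ℕ} (lab : Fin (usize q (a * 2)) → Fin (a * 2)) where
  down-label : Fin (usize q (a * 2)) → Fin a
  down-label i = proj₁ (remQuot {a} 2 (lab i))

  down-adjacent : Fin (usize q (a * 2)) → Bool
  down-adjacent i = unbit (proj₂ (remQuot {a} 2 (lab i)))

  pair-label : Fin (a * 2 ^ usize q (a * 2)) × Fin (suc (usize q (a * 2))) → Fin a
  pair-label (β , zero) = proj₁ (remQuot {a} (2 ^ usize q (a * 2)) β)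
  pair-label (β , suc i) = down-label i

  module _ (adjacent : Fin (usize q (a * 2)) → Fin (usize q (a * 2)) → Bool) where
    within : Fin (suc (usize q (a * 2))) → Fin (suc (usize q (a * 2))) → Bool
    within zero zero = false
    within zero (suc j) = down-adjacent j
    within (suc i) zero = down-adjacent i
    within (suc i) (suc j) = adjacent i j

    pair-adj : (x y : Fin (a * 2 ^ usize q (a * 2)) × Fin (suc (usize q (a * 2)))) → Bool
    pair-adj (β , o) (β′ , o′) = ⌊ β ≟ β′ ⌋ ∧ within o o′

ulab : ∀ q a → Fin (usize q a) → Fin a
ulab (suc q) a x = pair-label {q} (ulab q (a * 2)) (remQuot (suc (usize q (a * 2))) x)

uadj : ∀ q a → Fin (usize q a) → Fin (usize q a) → Bool
uadj (suc q) a x y = pair-adj {q} {a} (ulab q (a * 2)) (uadj q (a * 2))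
                       (remQuot (suc (usize q (a * 2))) x) (remQuot (suc (usize q (a * 2))) y)

-- The domain of the partial map `g` is the realised subset of the universal graph. As `f` lands in
-- it, this is label-preserving homomorphic equivalence between that subset and the subgraph induced
-- on `P`.
record Model (G : Graph) (q a : ℕ) (P : Subset (n G)) (lb : Fin (n G) → Fin a) : Set where
  field
    g : Fin (usize q a) → Maybe (Fin (n G))
    f : ∀ x → P x ≡ true → Fin (usize q a)
    g-label : ∀ i x → g i ≡ just x → P x ≡ true × lb x ≡ ulab q a i
    g-adj : ∀ i j x y → g i ≡ just x → g j ≡ just y → uadj q a i j ≡ true → adj G x y ≡ true
    f-label : ∀ x px → ulab q a (f x px) ≡ lb x
    f-present : ∀ x px → is-just (g (f x px)) ≡ true
    f-adj : ∀ x y px py → adj G x y ≡ true → uadj q a (f x px) (f y py) ≡ true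

module Components {G r N} (𝒞 : Centred G r N) where
  open Centred 𝒞
  private V = Fin (n G)

  -- After the tail is shortened, the whole walk has length at most `r`, so the colour of its vertex
  -- `m` of least rank occurs only once. The part from either end up to `m` then uses one colour
  -- less, and one further edge reaches `m`.
  shorten : ∀ q J → count J ≤ q → diam q < r → ∀ {P : V → Set} {k x y} → (∀ z → P z → J (χ z) ≡ true) →
            Walk G P k x y → Walk G P (diam q) x y
  shorten zero J le _ inJ w = contradiction (≤-trans (count≥1 J _ (inJ _ (walk-start w))) le) λ ()
  shorten (suc q) J le d inJ (here p) = here p
  shorten (suc q) J le d {P} {_} {x} {y} inJ (step p a w)
    with walk-support (step p a (shorten (suc q) J le d inJ w))
  ... | L , _ , x∈ , y∈ , inP , conn with argmin rank L x∈
  ... | m , m∈ , least = walk-++ (to-m x x∈) (walk-reverse (to-m y y∈))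
    where
    unique : ∀ z → z ∈ L → ¬ z ≡ m → ¬ χ z ≡ χ m
    unique z z∈ z≢m eq = centred _ z m d (walk-mono least ≤-refl (conn z m z∈ m∈)) (z≢m ∘ sym) (sym eq)
    to-m : ∀ z → z ∈ L → Walk G P (suc (diam q)) z m
    to-m z z∈ with walk-avoiding m (conn z m z∈ m∈)
    ... | inj₁ w′ = ⊥-elim (proj₂ (walk-end w′) refl)
    ... | inj₂ (inj₁ refl) = here (inP m m∈)
    ... | inj₂ (inj₂ (z′ , w′ , b)) = walk-snoc
      (walk-mono (λ u u∈ → inP u (proj₁ u∈)) ≤-refl
        (shorten q (J ─ χ m) (s≤s⁻¹ (≤-trans (count-─ J (χ m) (inJ m (inP m m∈))) le)) (≤-trans (s≤s (diam-≤ q)) d)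
          (λ { u (u∈ , u≢m) → ─-true J (inJ u (inP u u∈)) (unique u u∈ u≢m) }) w′))
      b (inP m m∈)

  module Roots (q : ℕ) (J : Subset N) (J-≤ : count J ≤ suc q) (d : diam (suc q) < r)
               (P : Subset (n G)) (P-J : ∀ x → P x ≡ true → J (χ x) ≡ true) where

    Conn : V → V → Set
    Conn x y = Walk G (λ z → P z ≡ true) (diam (suc q)) x y

    conn? : ∀ x y → Dec (Conn x y)
    conn? x = walk? (λ z → P z Bool.≟ true) (diam (suc q)) x

    conn-trans : ∀ {x y z} → Conn x y → Conn y z → Conn x z
    conn-trans w w′ = shorten (suc q) J J-≤ d P-J (walk-++ w w′)

    root-of : ∀ x → P x ≡ true → ∃ λ m → Conn x m × (∀ y → Conn x y → rank m ≤ rank y)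
    root-of x Px with argmin rank (members (λ y → ⌊ conn? x y ⌋)) (∈-members _ (⌊⌋-true (conn? x x) (here Px)))
    ... | m , m∈ , least = m , ⌊⌋-true⁻ (conn? x m) (∈-members⁻ (λ y → ⌊ conn? x y ⌋) m∈)
                         , λ y w → least y (∈-members (λ y → ⌊ conn? x y ⌋) (⌊⌋-true (conn? x y) w))

    abstract
      root : V → V
      root x with P x Bool.≟ true
      ... | yes Px = proj₁ (root-of x Px)
      ... | no _ = x

      root-conn : ∀ x → P x ≡ true → Conn x (root x)
      root-conn x Px with P x Bool.≟ true
      ... | yes Px′ = proj₁ (proj₂ (root-of x Px′))
      ... | no ¬Px = ⊥-elim (¬Px Px)

      root-least : ∀ x y → P x ≡ true → Conn x y → rank (root x) ≤ rank y
      root-least x y Px w with P x Bool.≟ true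
      ... | yes Px′ = proj₂ (proj₂ (root-of x Px′)) y w
      ... | no ¬Px = ⊥-elim (¬Px Px)

    root-∈ : ∀ x → P x ≡ true → P (root x) ≡ true
    root-∈ x Px = walk-end (root-conn x Px)

    root-same : ∀ x y → P x ≡ true → P y ≡ true → Conn x y → root x ≡ root y
    root-same x y Px Py w = rank-injective _ _ (≤-antisym
      (root-least x (root y) Px (conn-trans w (root-conn y Py)))
      (root-least y (root x) Py (conn-trans (walk-reverse w) (root-conn x Px))))

    -- The root has least rank in its component, so a short walk to it stays above it and
    -- centredness applies.
    root-unique : ∀ x → P x ≡ true → ¬ x ≡ root x → ¬ χ x ≡ χ (root x)
    root-unique x Px x≢ eq with walk-support (root-conn x Px)
    ... | L , _ , x∈ , m∈ , inP , conn = centred _ x (root x) (<⇒≤ d)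
      (walk-mono (λ z z∈ → root-least x z Px (walk-mono inP ≤-refl (conn x z x∈ z∈))) ≤-refl (conn x (root x) x∈ m∈))
      (x≢ ∘ sym) (sym eq)

    Below : V → V → Set
    Below m x = P x ≡ true × root x ≡ m × ¬ x ≡ m

    below? : ∀ m x → Dec (Below m x)
    below? m x = (P x Bool.≟ true) ×-dec (root x ≟ m) ×-dec ¬? (x ≟ m)

    below : V → Subset (n G)
    below m x = ⌊ below? m x ⌋

    -- Made empty for `m` outside `P`, where `below m` is empty as well, so that the induction
    -- covers every `m`.
    palette : V → Subset N
    palette m c = P m ∧ (J ─ χ m) c

    palette-≤ : ∀ m → count (palette m) ≤ q
    palette-≤ m with P m in Pm
    ... | true = s≤s⁻¹ (≤-trans (count-─ J (χ m) (P-J m Pm)) J-≤)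
    ... | false = ≤-trans (≤-reflexive (sum-replicate-zero N)) z≤n

    palette-below : ∀ m x → below m x ≡ true → palette m (χ x) ≡ true
    palette-below m x e with ⌊⌋-true⁻ (below? m x) e
    ... | Px , refl , x≢m = ∧-true (root-∈ x Px) (─-true J (P-J x Px) (root-unique x Px x≢m))

  module Assemble (q : ℕ) (J : Subset N) (J-≤ : count J ≤ suc q) (d : diam (suc q) < r)
                  (P : Subset (n G)) (P-J : ∀ x → P x ≡ true → J (χ x) ≡ true) (a : ℕ) (lb : V → Fin a)
                  (models : ∀ m → Model G q (a * 2) (Roots.below q J J-≤ d P P-J m) (λ x → combine (lb x) (bit (adj G x m)))) where
    open Roots q J J-≤ d P P-J
    module M m = Model (models m)

    s = usize q (a * 2)

    Block Vertex : Set
    Block = Fin (a * 2 ^ s)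
    Vertex = Block × Fin (suc s)

    split : Fin (usize (suc q) a) → Vertex
    split = remQuot (suc s)

    join : Vertex → Fin (usize (suc q) a)
    join (β , o) = combine β o

    split-join : ∀ v → split (join v) ≡ v
    split-join (β , o) = remQuot-combine β o

    label : Vertex → Fin a
    label = pair-label {q} (ulab q (a * 2))

    adjacent : Vertex → Vertex → Bool
    adjacent = pair-adj {q} {a} (ulab q (a * 2)) (uadj q (a * 2))

    block : V → Block
    block m = combine (lb m) (encode (is-just ∘ M.g m))

    -- Components with equal root label and equal realised subset share a block. `f` sends all of
    -- them there, while `g` maps the block back to a single representative.
    Rep : Block → Set
    Rep β = ∃ λ m → P m ≡ true × root m ≡ m × block m ≡ β

    rep? : ∀ β → Dec (Rep β)
    rep? β = any? (λ m → (P m Bool.≟ true) ×-dec (root m ≟ m) ×-dec (block m ≟ β))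

    realise : ∀ {β} → Dec (Rep β) → Fin (suc s) → Maybe V
    realise (no _) _ = nothing
    realise (yes (m , _)) zero = just m
    realise (yes (m , _)) (suc i) = M.g m i

    realise-label : ∀ β (R : Dec (Rep β)) o x → realise R o ≡ just x → P x ≡ true × lb x ≡ label (β , o)
    realise-label .(block m) (yes (m , Pm , _ , refl)) zero .m refl =
      Pm , sym (cong proj₁ (remQuot-combine (lb m) _))
    realise-label β (yes (m , Pm , _ , _)) (suc i) x eq with M.g-label m i x eq
    ... | x∈ , l = proj₁ (⌊⌋-true⁻ (below? m x) x∈)
                 , trans (sym (cong proj₁ (remQuot-combine (lb x) (bit (adj G x m))))) (cong (proj₁ ∘ remQuot {a} 2) l)

    labelled-adj : ∀ m x i → combine (lb x) (bit (adj G x m)) ≡ ulab q (a * 2) i →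
                   down-adjacent {q} {a} (ulab q (a * 2)) i ≡ adj G x m
    labelled-adj m x i eq = trans (cong (λ l → unbit (proj₂ (remQuot {a} 2 l))) (sym eq))
      (trans (cong (unbit ∘ proj₂) (remQuot-combine (lb x) (bit (adj G x m)))) (unbit-bit (adj G x m)))

    realise-adj : ∀ β (R : Dec (Rep β)) o o′ x y → realise R o ≡ just x → realise R o′ ≡ just y →
                  within {q} {a} (ulab q (a * 2)) (uadj q (a * 2)) o o′ ≡ true → adj G x y ≡ true
    realise-adj β (yes (m , _)) zero (suc j) .m y refl eq′ e =
      trans (adj-sym G m y) (trans (sym (labelled-adj m y j (proj₂ (M.g-label m j y eq′)))) e)
    realise-adj β (yes (m , _)) (suc i) zero x .m eq refl e = trans (sym (labelled-adj m x i (proj₂ (M.g-label m i x eq)))) e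
    realise-adj β (yes (m , _)) (suc i) (suc j) x y eq eq′ e = M.g-adj m i j x y eq eq′ e

    g : Fin (usize (suc q) a) → Maybe V
    g v = realise (rep? (proj₁ (split v))) (proj₂ (split v))

    place : ∀ m x → P x ≡ true → root x ≡ m → Dec (x ≡ m) → Fin (suc s)
    place m x Px eq (yes _) = zero
    place m x Px eq (no x≢m) = suc (M.f m x (⌊⌋-true (below? m x) (Px , eq , x≢m)))

    vertex : ∀ m x → P x ≡ true → root x ≡ m → Vertex
    vertex m x Px eq = block m , place m x Px eq (x ≟ m)

    f : ∀ x → P x ≡ true → Fin (usize (suc q) a)
    f x Px = join (vertex (root x) x Px refl)

    f-at : ∀ m x Px (eq : root x ≡ m) → f x Px ≡ join (vertex m x Px eq)
    f-at m x Px refl = refl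

    place-label : ∀ m x Px eq D → label (block m , place m x Px eq D) ≡ lb x
    place-label m .m Px eq (yes refl) = cong proj₁ (remQuot-combine (lb m) _)
    place-label m x Px eq (no x≢m) =
      trans (cong (proj₁ ∘ remQuot {a} 2) (M.f-label m x _)) (cong proj₁ (remQuot-combine (lb x) (bit (adj G x m))))

    -- The representative may belong to another component, but the block encodes the realised
    -- subset, so it realises the same vertices.
    place-present : ∀ m x Px eq D (R : Dec (Rep (block m))) → is-just (realise R (place m x Px eq D)) ≡ true
    place-present m x Px eq D (no ¬R) = ⊥-elim (¬R (m , Pm , trans (root-same m x Pm Px (walk-reverse x-m)) eq , refl))
      where
      x-m : Conn x m
      x-m = subst (Conn x) eq (root-conn x Px)
      Pm = walk-end x-m
    place-present m x Px eq (yes _) (yes (m′ , _)) = refl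
    place-present m x Px eq (no x≢m) (yes (m′ , _ , _ , same)) = trans
      (encode-injective (is-just ∘ M.g m′) (is-just ∘ M.g m) codes _) (M.f-present m x _)
      where
      codes : encode (is-just ∘ M.g m′) ≡ encode (is-just ∘ M.g m)
      codes = trans (sym (cong proj₂ (remQuot-combine (lb m′) (encode (is-just ∘ M.g m′)))))
             (trans (cong (proj₂ ∘ remQuot {a} (2 ^ s)) same)
                    (cong proj₂ (remQuot-combine (lb m) (encode (is-just ∘ M.g m)))))

    place-adj : ∀ m x y Px Py eq eq′ D D′ → adj G x y ≡ true →
      within {q} {a} (ulab q (a * 2)) (uadj q (a * 2)) (place m x Px eq D) (place m y Py eq′ D′) ≡ true
    place-adj m .m .m Px Py eq eq′ (yes refl) (yes refl) e = ⊥-elim (true≢false e (adj-irr G m))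
    place-adj m .m y Px Py eq eq′ (yes refl) (no y≢m) e =
      trans (labelled-adj m y _ (sym (M.f-label m y _))) (trans (adj-sym G y m) e)
    place-adj m x .m Px Py eq eq′ (no x≢m) (yes refl) e = trans (labelled-adj m x _ (sym (M.f-label m x _))) e
    place-adj m x y Px Py eq eq′ (no x≢m) (no y≢m) e = M.f-adj m x y _ _ e

    assembled : Model G (suc q) a P lb
    assembled = record
      { g = g ; f = f
      ; g-label = λ v x → realise-label _ (rep? (proj₁ (split v))) (proj₂ (split v)) x
      ; g-adj = λ v w → g-adj (split v) (split w)
      ; f-label = λ x Px → trans (cong label (split-join (vertex (root x) x Px refl))) (place-label (root x) x Px refl (x ≟ root x))
      ; f-present = λ x Px → trans (cong (λ (v : Vertex) → is-just (realise (rep? (proj₁ v)) (proj₂ v))) (split-join (vertex (root x) x Px refl)))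
                                   (place-present (root x) x Px refl (x ≟ root x) (rep? (block (root x))))
      ; f-adj = f-adj }
      where
      g-adj : ∀ v w x y → realise (rep? (proj₁ v)) (proj₂ v) ≡ just x → realise (rep? (proj₁ w)) (proj₂ w) ≡ just y →
              adjacent v w ≡ true → adj G x y ≡ true
      g-adj (β , o) (β′ , o′) x y p p′ e with ∧-true⁻ ⌊ β ≟ β′ ⌋ e
      ... | same , e′ with ⌊⌋-true⁻ (β ≟ β′) same
      ... | refl = realise-adj β (rep? β) o o′ x y p p′ e′
      f-adj : ∀ x y Px Py → adj G x y ≡ true → uadj (suc q) a (f x Px) (f y Py) ≡ true
      f-adj x y Px Py e = trans
        (cong₂ adjacent (split-join (vertex m x Px refl)) (trans (cong split (f-at m y Py root-y)) (split-join (vertex m y Py root-y))))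
        (∧-true (⌊⌋-true (block m ≟ block m) refl) (place-adj m x y Px Py refl root-y (x ≟ m) (y ≟ m) e))
        where
        m = root x
        root-y : root y ≡ m
        root-y = sym (root-same x y Px Py (step Px e (here Py)))

  model : ∀ q a J → count J ≤ q → diam q < r → ∀ P → (∀ x → P x ≡ true → J (χ x) ≡ true) → ∀ lb → Model G q a P lb
  model zero a J J-≤ d P P-J lb = record
    { g = λ () ; f = λ x Px → none x Px ; g-label = λ () ; g-adj = λ () ; f-label = λ x Px → none x Px
    ; f-present = λ x Px → none x Px ; f-adj = λ x _ Px → none x Px }
    where
    none : ∀ {A : Set} x → P x ≡ true → A
    none x Px = contradiction (≤-trans (count≥1 J _ (P-J x Px)) J-≤) λ ()
  model (suc q) a J J-≤ d P P-J lb = Assemble.assembled q J J-≤ d P P-J a lb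
    (λ m → model q (a * 2) (palette m) (palette-≤ m) (≤-trans (s≤s (diam-≤ q)) d) (below m) (palette-below m) _)
    where open Roots q J J-≤ d P P-J

-- Homomorphisms

hom-∘ : ∀ {F G H} → G ⟶ H → F ⟶ G → F ⟶ H
hom-∘ (g , g-adj) (f , f-adj) = g ∘ f , λ u v e → g-adj _ _ (f-adj u v e)

hom? : ∀ F G → Dec (F ⟶ G)
hom? F G = map′ (λ { (k , h) → finToFun k , h }) (λ { (f , h) → funToFin f , λ u v e →
    subst₂ (λ x y → adj G x y ≡ true) (sym (finToFun-funToFin f u)) (sym (finToFun-funToFin f v)) (h u v e) })
  (any? λ k → all? λ u → all? λ v → (adj F u v Bool.≟ true) →-dec (adj G (finToFun {n G} {n F} k u) (finToFun {n G} {n F} k v) Bool.≟ true))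

empty : Graph
empty = record { n = 0 ; adj = λ () ; adj-sym = λ () ; adj-irr = λ () }

module _ (G H : Graph) where
  ⊎-adj : Fin (n G) ⊎ Fin (n H) → Fin (n G) ⊎ Fin (n H) → Bool
  ⊎-adj (inj₁ u) (inj₁ v) = adj G u v
  ⊎-adj (inj₂ u) (inj₂ v) = adj H u v
  ⊎-adj _ _ = false

  _⊎ᴳ_ : Graph
  _⊎ᴳ_ = record
    { n = n G + n H ; adj = λ u v → ⊎-adj (splitAt (n G) u) (splitAt (n G) v)
    ; adj-sym = λ u v → symm (splitAt (n G) u) (splitAt (n G) v) ; adj-irr = λ v → irr (splitAt (n G) v) }
    where
    symm : ∀ u v → ⊎-adj u v ≡ ⊎-adj v u
    symm (inj₁ u) (inj₁ v) = adj-sym G u v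
    symm (inj₁ u) (inj₂ v) = refl
    symm (inj₂ u) (inj₁ v) = refl
    symm (inj₂ u) (inj₂ v) = adj-sym H u v
    irr : ∀ v → ⊎-adj v v ≡ false
    irr (inj₁ v) = adj-irr G v
    irr (inj₂ v) = adj-irr H v

  inl : G ⟶ _⊎ᴳ_
  inl = (_↑ˡ n H) , λ u v e → trans (cong₂ ⊎-adj (splitAt-↑ˡ (n G) u (n H)) (splitAt-↑ˡ (n G) v (n H))) e

  inr : H ⟶ _⊎ᴳ_
  inr = (n G ↑ʳ_) , λ u v e → trans (cong₂ ⊎-adj (splitAt-↑ʳ (n G) (n H) u) (splitAt-↑ʳ (n G) (n H) v)) e

  one-side : ∀ {F} → NonEmpty F → Connected F → F ⟶ _⊎ᴳ_ → F ⟶ G ⊎ F ⟶ H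
  one-side {F} ne conn (f , f-adj) with splitAt (n G) (f (fromℕ< ne)) in eq₀
  ... | inj₁ a₀ = inj₁ ((λ v → proj₁ (left v)) , λ u v e → subst₂ (λ x y → ⊎-adj x y ≡ true) (proj₂ (left u)) (proj₂ (left v)) (f-adj u v e))
    where
    go : ∀ {k u v} → Walk F (λ _ → ⊤) k u v → (∃ λ a → splitAt (n G) (f u) ≡ inj₁ a) → ∃ λ a → splitAt (n G) (f v) ≡ inj₁ a
    go (here _) p = p
    go {u = u} (step {y = y} _ e w) (a , p) with splitAt (n G) (f y) in eq | f-adj u y e
    ... | inj₁ b | _ = go w (b , eq)
    ... | inj₂ b | e′ rewrite p = contradiction e′ λ ()
    left : ∀ v → ∃ λ a → splitAt (n G) (f v) ≡ inj₁ a
    left v = go (proj₂ (conn (fromℕ< ne) v)) (a₀ , eq₀)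
  ... | inj₂ a₀ = inj₂ ((λ v → proj₁ (right v)) , λ u v e → subst₂ (λ x y → ⊎-adj x y ≡ true) (proj₂ (right u)) (proj₂ (right v)) (f-adj u v e))
    where
    go : ∀ {k u v} → Walk F (λ _ → ⊤) k u v → (∃ λ a → splitAt (n G) (f u) ≡ inj₂ a) → ∃ λ a → splitAt (n G) (f v) ≡ inj₂ a
    go (here _) p = p
    go {u = u} (step {y = y} _ e w) (a , p) with splitAt (n G) (f y) in eq | f-adj u y e
    ... | inj₂ b | _ = go w (b , eq)
    ... | inj₁ b | e′ rewrite p = contradiction e′ λ ()
    right : ∀ v → ∃ λ a → splitAt (n G) (f v) ≡ inj₂ a
    right v = go (proj₂ (conn (fromℕ< ne) v)) (a₀ , eq₀)

⋃ : ∀ {k} → (Fin k → Graph) → Graph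
⋃ {zero} X = empty
⋃ {suc k} X = X zero ⊎ᴳ ⋃ (X ∘ suc)

⋃-inject : ∀ {k} (X : Fin k → Graph) i → X i ⟶ ⋃ X
⋃-inject X zero = inl (X zero) (⋃ (X ∘ suc))
⋃-inject X (suc i) = hom-∘ {X (suc i)} {⋃ (X ∘ suc)} {⋃ X} (inr (X zero) (⋃ (X ∘ suc))) (⋃-inject (X ∘ suc) i)

↛empty : ∀ {F} → NonEmpty F → ¬ F ⟶ empty
↛empty ne (f , _) = contradiction (f (fromℕ< ne)) λ ()

⋃-project : ∀ {k} (X : Fin k → Graph) {F} → NonEmpty F → Connected F → F ⟶ ⋃ X → ∃ λ i → F ⟶ X i
⋃-project {zero} X {F} ne conn h = ⊥-elim (↛empty {F} ne h)
⋃-project {suc k} X {F} ne conn h with one-side (X zero) (⋃ (X ∘ suc)) {F} ne conn h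
... | inj₁ h₀ = zero , h₀
... | inj₂ h₁ with ⋃-project (X ∘ suc) {F} ne conn h₁
... | i , hᵢ = suc i , hᵢ

count-image : ∀ {k m} (φ : Fin k → Fin m) → count (λ i → ⌊ any? (λ u → i ≟ φ u) ⌋) ≤ k
count-image {k} {m} φ = begin
  count (λ i → ⌊ any? (λ u → i ≟ φ u) ⌋)                           ≤⟨ sum-mono-≤ bound ⟩
  sum (λ i → sum (λ u → if ⌊ i ≟ φ u ⌋ then 1 else 0))            ≡⟨ ∑-comm {m} {k} (λ i u → if ⌊ i ≟ φ u ⌋ then 1 else 0) ⟩
  sum (λ u → sum (λ i → if ⌊ i ≟ φ u ⌋ then 1 else 0))            ≡⟨ sum-cong-≗ (λ u → sum-point (λ _ → 1) (φ u)) ⟩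
  sum {k} (λ _ → 1)                                                ≡⟨ trans (sum-const k 1) (*-identityʳ k) ⟩
  k                                                                ∎
  where
  open ≤-Reasoning
  bound : ∀ i → ι ⌊ any? (λ u → i ≟ φ u) ⌋ ≤ sum (λ u → if ⌊ i ≟ φ u ⌋ then 1 else 0)
  bound i with any? (λ u → i ≟ φ u)
  ... | no _ = z≤n
  ... | yes (u , eq) = ≤-trans (≤-reflexive (cong (λ b → if b then 1 else 0) (sym (⌊⌋-true (i ≟ φ u) eq)))) (≤-sum _ u)

-- The truncated product: a vertex consists of a colour and, for every colour set I,
-- a vertex of the universal graph for I (or zero, if it has none); Q selects the realised subsets.
module Truncated (p N : ℕ) where
  s = usize p 1

  Types : Set
  Types = Fin (2 ^ N) → Subset s

  compatible : Subset s → Fin (suc s) → Fin (suc s) → Bool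
  compatible Q zero _ = false
  compatible Q (suc u) zero = false
  compatible Q (suc u) (suc v) = Q u ∧ (Q v ∧ uadj p 1 u v)

  Point : Set
  Point = Fin N × Fin (suc s ^ 2 ^ N)

  -- A colour set constrains only pairs with both colours in it: a vertex has a meaningful
  -- coordinate only for sets that contain its colour.
  Adjacent : Types → Point → Point → Set
  Adjacent Q (i , φ) (j , ψ) = ¬ i ≡ j × (∀ I → count (decode {N} I) ≤ p → decode {N} I i ≡ true → decode {N} I j ≡ true →
                                             compatible (Q I) (finToFun φ I) (finToFun ψ I) ≡ true)

  adjacent? : ∀ Q x y → Dec (Adjacent Q x y)
  adjacent? Q (i , φ) (j , ψ) = ¬? (i ≟ j) ×-dec all? λ I → (count (decode {N} I) ≤? p) →-dec
    ((decode {N} I i Bool.≟ true) →-dec ((decode {N} I j Bool.≟ true) →-dec (compatible (Q I) (finToFun φ I) (finToFun ψ I) Bool.≟ true)))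

  point : Fin (N * suc s ^ 2 ^ N) → Point
  point = remQuot (suc s ^ 2 ^ N)

  -- Symmetry is imposed here instead of being derived from that of `uadj`.
  both? : ∀ Q x y → Dec (Adjacent Q x y × Adjacent Q y x)
  both? Q x y = adjacent? Q x y ×-dec adjacent? Q y x

  truncated : Types → Graph
  truncated Q = record
    { n = N * suc s ^ 2 ^ N
    ; adj = λ x y → ⌊ both? Q (point x) (point y) ⌋
    ; adj-sym = λ x y → bool-ext (symm x y) (symm y x)
    ; adj-irr = λ x → ⌊⌋-false (both? Q (point x) (point x)) (λ h → proj₁ (proj₁ h) refl) }
    where
    symm : ∀ x y → ⌊ both? Q (point x) (point y) ⌋ ≡ true → ⌊ both? Q (point y) (point x) ⌋ ≡ true
    symm x y e = ⌊⌋-true (both? Q (point y) (point x)) (Product.swap (⌊⌋-true⁻ (both? Q (point x) (point y)) e))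

  -- Numbering the families of realised subsets makes the truncated products a finite family that
  -- does not mention `G`.
  types : Fin ((2 ^ s) ^ 2 ^ N) → Types
  types κ I = decode (finToFun κ I)

  type-code : Types → Fin ((2 ^ s) ^ 2 ^ N)
  type-code Q = funToFin (encode ∘ Q)

  types-code : ∀ Q I u → types (type-code Q) I u ≡ Q I u
  types-code Q I u = trans (cong (λ c → decode c u) (finToFun-funToFin (encode ∘ Q) I)) (decode-encode (Q I) u)

  module Of {G r} (𝒞 : Centred G r N) (d : diam p < r) where
    open Centred 𝒞
    open Components 𝒞
    V = Fin (n G)

    palette : Fin (2 ^ N) → Subset N
    palette I i = ⌊ count (decode {N} I) ≤? p ⌋ ∧ decode {N} I i

    palette-≤ : ∀ I → count (palette I) ≤ p
    palette-≤ I with count (decode {N} I) ≤? p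
    ... | yes le = le
    ... | no _ = ≤-trans (≤-reflexive (sum-replicate-zero N)) z≤n

    palette-true : ∀ I {i} → count (decode {N} I) ≤ p → decode {N} I i ≡ true → palette I i ≡ true
    palette-true I le h = ∧-true (⌊⌋-true (count (decode {N} I) ≤? p) le) h

    abstract
      models : ∀ I → Model G p 1 (palette I ∘ χ) (λ _ → zero)
      models I = model p 1 (palette I) (palette-≤ I) d (palette I ∘ χ) (λ _ h → h) (λ _ → zero)

    module M I = Model (models I)

    Q : Types
    Q I u = is-just (M.g I u)

    X : Graph
    X = truncated (types (type-code Q))

    compatible-cong : ∀ {Q Q′ : Subset s} → (∀ u → Q u ≡ Q′ u) → ∀ a b → compatible Q a b ≡ compatible Q′ a b
    compatible-cong h zero b = refl
    compatible-cong h (suc u) zero = refl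
    compatible-cong h (suc u) (suc v) = cong₂ (λ q q′ → q ∧ (q′ ∧ uadj p 1 u v)) (h u) (h v)

    coordinate : ∀ I x → Dec (palette I (χ x) ≡ true) → Fin (suc s)
    coordinate I x (yes h) = suc (M.f I x h)
    coordinate I x (no _) = zero

    coordinates : V → Fin (2 ^ N) → Fin (suc s)
    coordinates x I = coordinate I x (palette I (χ x) Bool.≟ true)

    to : V → Point
    to x = χ x , funToFin (coordinates x)

    proper : ∀ x y → adj G x y ≡ true → ¬ χ x ≡ χ y
    proper x y e eq with ≤-total (rank x) (rank y)
    ... | inj₁ le = centred 1 y x (≤-trans (s≤s z≤n) d) (step le (trans (adj-sym G y x) e) (here ≤-refl)) x≢y eq
      where
      x≢y : ¬ x ≡ y
      x≢y refl = true≢false e (adj-irr G x)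
    ... | inj₂ le = centred 1 x y (≤-trans (s≤s z≤n) d) (step le e (here ≤-refl)) y≢x (sym eq)
      where
      y≢x : ¬ y ≡ x
      y≢x refl = true≢false e (adj-irr G x)

    coordinate-compatible : ∀ I x y → adj G x y ≡ true → palette I (χ x) ≡ true → palette I (χ y) ≡ true →
      ∀ D D′ → compatible (Q I) (coordinate I x D) (coordinate I y D′) ≡ true
    coordinate-compatible I x y e hx hy (no ¬h) _ = ⊥-elim (¬h hx)
    coordinate-compatible I x y e hx hy (yes _) (no ¬h) = ⊥-elim (¬h hy)
    coordinate-compatible I x y e _ _ (yes hx) (yes hy) =
      ∧-true (M.f-present I x hx) (∧-true (M.f-present I y hy) (M.f-adj I x y hx hy e))

    to-adj : ∀ x y → adj G x y ≡ true → Adjacent (types (type-code Q)) (to x) (to y)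
    to-adj x y e = proper x y e , λ I le hx hy →
      trans (cong₂ (compatible (types (type-code Q) I)) (finToFun-funToFin (coordinates x) I) (finToFun-funToFin (coordinates y) I))
     (trans (compatible-cong (types-code Q I) (coordinates x I) (coordinates y I))
            (coordinate-compatible I x y e (palette-true I le hx) (palette-true I le hy)
              (palette I (χ x) Bool.≟ true) (palette I (χ y) Bool.≟ true)))

    to-truncated : G ⟶ X
    to-truncated = (λ x → combine (χ x) (funToFin (coordinates x))) , λ x y e →
      ⌊⌋-true (both? (types (type-code Q)) (point (combine (χ x) (funToFin (coordinates x)))) (point (combine (χ y) (funToFin (coordinates y)))))
        (subst₂ (λ a b → Adjacent (types (type-code Q)) a b × Adjacent (types (type-code Q)) b a)
          (sym (remQuot-combine (χ x) _)) (sym (remQuot-combine (χ y) _))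
          (to-adj x y e , to-adj y x (trans (adj-sym G y x) e)))

    -- The image of `F` uses at most `p` colours; with `I` the set of these, every edge of `F` is
    -- constrained at `I`. Hence the coordinate at `I` maps edges into the realised subset, and
    -- `M.g` returns them to `G`. The default `x₀` can only be taken at isolated vertices.
    from-truncated : V → ∀ F → n F ≤ p → F ⟶ X → F ⟶ G
    from-truncated x₀ F F≤p (h , h-adj) = (λ u → lift (coord u)) , λ u v e →
      let adjacent = proj₁ (⌊⌋-true⁻ (both? (types (type-code Q)) (point (h u)) (point (h v))) (h-adj u v e))
      in lift-adj (coord u) (coord v) (trans (sym (compatible-cong (types-code Q I) (coord u) (coord v)))
           (proj₂ adjacent I I-≤ (I-∋ u) (I-∋ v)))
      where
      colour : Fin (n F) → Fin N
      colour u = proj₁ (point (h u))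
      image : Subset N
      image i = ⌊ any? (λ u → i ≟ colour u) ⌋
      I : Fin (2 ^ N)
      I = encode image
      I-≤ : count (decode {N} I) ≤ p
      I-≤ = ≤-trans (≤-reflexive (sum-cong-≗ (λ i → cong ι (decode-encode image i)))) (≤-trans (count-image colour) F≤p)
      I-∋ : ∀ u → decode {N} I (colour u) ≡ true
      I-∋ u = trans (decode-encode image (colour u)) (⌊⌋-true (any? (λ v → colour u ≟ colour v)) (u , refl))
      coord : Fin (n F) → Fin (suc s)
      coord u = finToFun (proj₂ (point (h u))) I
      lift : Fin (suc s) → V
      lift zero = x₀
      lift (suc i) = fromMaybe x₀ (M.g I i)
      lift-adj : ∀ a b → compatible (Q I) a b ≡ true → adj G (lift a) (lift b) ≡ true
      lift-adj (suc i) (suc j) e with M.g I i in eqi | M.g I j in eqj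
      ... | just x | just y = M.g-adj I i j x y eqi eqj e

    represented : V → ∀ F → n F ≤ p → ¬ F ⟶ G → ∃ λ κ → G ⟶ truncated (types κ) × ¬ F ⟶ truncated (types κ)
    represented x₀ F F≤p F↛G = type-code Q , to-truncated , λ h → F↛G (from-truncated x₀ F F≤p h)

-- Restricted duals from centred colourings

Dual : Class → Graph → Set
Dual C F = ∃ λ D → ¬ (F ⟶ D) × (∀ G → C G → (F ⟶ G → ¬ (G ⟶ D)) × (¬ (G ⟶ D) → F ⟶ G))

dual-of-centred : ∀ {C : Class} {r N} F → NonEmpty F → Connected F → diam (n F) < r → (∀ G → C G → Centred G r N) → Dual C F
dual-of-centred {C} {r} {N} F ne conn d centred = D , F↛D , λ G G∈C → (λ h h′ → F↛D (hom-∘ {F} {G} {D} h′ h)) , complete G G∈C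
  where
  open Truncated (n F) N
  -- A product that receives `F` is replaced by the empty graph, so the union can range over all
  -- codes.
  keep : ∀ Y → Dec (F ⟶ Y) → Graph
  keep Y (yes _) = empty
  keep Y (no _) = Y
  keep-free : ∀ Y d → ¬ F ⟶ keep Y d
  keep-free Y (yes _) = ↛empty {F} ne
  keep-free Y (no ¬h) = ¬h
  to-kept : ∀ {G} Y d → ¬ F ⟶ Y → G ⟶ Y → G ⟶ keep Y d
  to-kept Y (yes h) ¬h _ = ⊥-elim (¬h h)
  to-kept Y (no _) _ g = g
  abstract
    member : Fin ((2 ^ s) ^ 2 ^ N) → Graph
    member κ = keep (truncated (types κ)) (hom? F (truncated (types κ)))
    member-free : ∀ κ → ¬ F ⟶ member κ
    member-free κ = keep-free (truncated (types κ)) (hom? F (truncated (types κ)))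
    to-member : ∀ {G} κ → ¬ F ⟶ truncated (types κ) → G ⟶ truncated (types κ) → G ⟶ member κ
    to-member {G} κ = to-kept {G} (truncated (types κ)) (hom? F (truncated (types κ)))
    D : Graph
    D = ⋃ member
    member⟶D : ∀ κ → member κ ⟶ D
    member⟶D = ⋃-inject member
    F↛D : ¬ F ⟶ D
    F↛D h = let κ , h′ = ⋃-project member {F} ne conn h in member-free κ h′
  complete : ∀ G → C G → ¬ (G ⟶ D) → F ⟶ G
  complete G G∈C ¬h with hom? F G
  ... | yes h = h
  ... | no F↛G = ⊥-elim (¬h (bound (n G) refl))
    where
    bound : ∀ k → n G ≡ k → G ⟶ D
    -- A graph without vertices offers no default vertex `x₀`, but it maps anywhere.
    bound zero eq = (λ x → contradiction (subst Fin eq x) λ ()) , λ x → contradiction (subst Fin eq x) λ ()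
    bound (suc k) eq with Of.represented (centred G G∈C) d (subst Fin (sym eq) zero) F ≤-refl F↛G
    ... | κ , h , F↛ = hom-∘ {G} {member κ} {D} (member⟶D κ) (to-member {G} κ F↛ h)

duality : ∀ C → BoundedExpansion C → HasAllRestrictedDualities C
duality C be F ne conn with be (suc (diam (n F)) + suc (diam (n F)))
... | c , sparse = dual-of-centred F ne conn ≤-refl (λ G G∈C → centred-colouring G (suc (diam (n F))) c (λ H → sparse G H G∈C))

-- Iterated subdivision

-- The weight of an edge is the number of vertices by which it is to be subdivided.

Weight : Graph → Set
Weight G = Fin (n G) → Fin (n G) → ℕ

-- The length enters through an equation so that walks can be matched whatever the form of their
-- length.
data WWalk (G : Graph) (w : Weight G) : ℕ → Fin (n G) → Fin (n G) → Set where
  nil : ∀ {x} → WWalk G w 0 x x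
  cons : ∀ {k l x y z} → adj G x y ≡ true → WWalk G w k y z → l ≡ suc (w x y + k) → WWalk G w l x z

EWalk : (G : Graph) → ℕ → Fin (n G) → Fin (n G) → Set
EWalk G = WWalk G (λ _ _ → 0)

Symmetric : (G : Graph) → Weight G → Set
Symmetric G w = ∀ x y → w x y ≡ w y x

module _ {G : Graph} {w : Weight G} where
  wwalk-++ : ∀ {k l x y z} → WWalk G w k x y → WWalk G w l y z → WWalk G w (k + l) x z
  wwalk-++ nil q = q
  wwalk-++ {l = l} (cons {k} {x = x} {y} a p refl) q = cons a (wwalk-++ p q) (cong suc (+-assoc (w x y) k l))

  wwalk-edge : ∀ {x y} → adj G x y ≡ true → WWalk G w (suc (w x y)) x y
  wwalk-edge {x} {y} a = cons a nil (cong suc (sym (+-identityʳ (w x y))))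

  wwalk-reverse : Symmetric G w → ∀ {k x y} → WWalk G w k x y → WWalk G w k y x
  wwalk-reverse w-sym nil = nil
  wwalk-reverse w-sym {l} {x} {z} (cons {k} {y = y} a p refl) =
    subst (λ m → WWalk G w m z x) (trans (+-comm k _) (cong (λ m → suc (m + k)) (w-sym y x)))
      (wwalk-++ (wwalk-reverse w-sym p) (wwalk-edge (trans (adj-sym G y x) a)))

-- Closed walks replace cycles because they can be concatenated, rotated and mapped without concern
-- for repeated vertices.
NoShortOdd : (G : Graph) → Weight G → ℕ → Set
NoShortOdd G w g = ∀ k x → parity k ≡ 1ℙ → k ≤ g → ¬ WWalk G w k x x

parity-suc : ∀ k → parity (suc k) ≡ parity k ⁻¹
parity-suc zero = refl
parity-suc (suc zero) = refl
parity-suc (suc (suc k)) = parity-suc k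

parity-double : ∀ i → parity (i + i) ≡ 0ℙ
parity-double i = trans (Parity.+-homo-+ i i) (Parity.p+p≡0ℙ (parity i))

record Subdivided (G₀ G : Graph) (w : Weight G) : Set where
  field
    graph : Graph
    subdivision : IsSubdivisionOf graph G₀
    pull : ∀ X → graph ⟶ X → ∃ λ (φ : Fin (n G) → Fin (n X)) → ∀ x y → adj G x y ≡ true → EWalk X (suc (w x y)) (φ x) (φ y)
    girth : ∀ g → NoShortOdd G w g → NoShortOdd graph (λ _ _ → 0) g

module SubdivideEdge (G : Graph) (w : Weight G) (w-sym : Symmetric G w) (u v : Fin (n G)) (uv : adj G u v ≡ true)
                     (k : ℕ) (w-uv : w u v ≡ suc k) where
  private V = Fin (n G)

  G′ : Graph
  G′ = subdivideEdge G u v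

  u≢v : ¬ u ≡ v
  u≢v refl = true≢false uv (adj-irr G u)

  -- The remaining `k` subdivisions all go to the half of the edge at `v`; the half at `u` is
  -- finished.
  toward : V → ℕ
  toward y = if ⌊ y ≟ v ⌋ then k else 0

  w′ : Weight G′
  w′ zero zero = 0
  w′ zero (suc y) = toward y
  w′ (suc x) zero = toward x
  w′ (suc x) (suc y) = w x y

  toward-u : toward u ≡ 0
  toward-u = cong (λ b → if b then k else 0) (⌊⌋-false (u ≟ v) u≢v)

  toward-v : toward v ≡ k
  toward-v = cong (λ b → if b then k else 0) (⌊⌋-true (v ≟ v) refl)

  w′-sym : Symmetric G′ w′
  w′-sym zero zero = refl
  w′-sym zero (suc y) = refl
  w′-sym (suc x) zero = refl
  w′-sym (suc x) (suc y) = w-sym x y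

  Pair : V → V → Set
  Pair x y = (x ≡ u × y ≡ v) ⊎ (x ≡ v × y ≡ u)

  old-adj : ∀ x y → adj G x y ≡ true → Pair x y ⊎ adj G′ (suc x) (suc y) ≡ true
  old-adj x y a with x ≟ u | y ≟ v | x ≟ v | y ≟ u
  ... | yes p | yes q | _ | _ = inj₁ (inj₁ (p , q))
  ... | yes p | no _ | yes p′ | _ = ⊥-elim (u≢v (trans (sym p) p′))
  ... | yes _ | no _ | no _ | _ = inj₂ (∧-true a refl)
  ... | no _ | _ | yes p | yes q = inj₁ (inj₂ (p , q))
  ... | no _ | _ | yes _ | no _ = inj₂ (∧-true a refl)
  ... | no _ | _ | no _ | _ = inj₂ (∧-true a refl)

  pair-removed : ∀ x y → Pair x y → adj G′ (suc x) (suc y) ≡ false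
  pair-removed x y (inj₁ (refl , refl)) with u ≟ u | v ≟ v
  ... | yes _ | yes _ = ∧-zeroʳ (adj G u v)
  ... | no ¬p | _ = ⊥-elim (¬p refl)
  ... | yes _ | no ¬p = ⊥-elim (¬p refl)
  pair-removed x y (inj₂ (refl , refl)) with v ≟ u | v ≟ v | u ≟ u
  ... | yes p | _ | _ = ⊥-elim (u≢v (sym p))
  ... | no _ | yes _ | yes _ = ∧-zeroʳ (adj G v u)
  ... | no _ | no ¬p | _ = ⊥-elim (¬p refl)
  ... | no _ | yes _ | no ¬p = ⊥-elim (¬p refl)

  old-adj⁻ : ∀ x y → adj G′ (suc x) (suc y) ≡ true → adj G x y ≡ true × ¬ Pair x y
  old-adj⁻ x y a = proj₁ (∧-true⁻ (adj G x y) a) , λ p → true≢false a (pair-removed x y p)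

  new-adj⁻ : ∀ y → adj G′ zero (suc y) ≡ true → y ≡ u ⊎ y ≡ v
  new-adj⁻ y a with y ≟ u | y ≟ v
  ... | yes p | _ = inj₁ p
  ... | no _ | yes q = inj₂ q

  new-adj-u : adj G′ zero (suc u) ≡ true
  new-adj-u with u ≟ u
  ... | yes _ = refl
  ... | no ¬p = ⊥-elim (¬p refl)

  new-adj-v : adj G′ zero (suc v) ≡ true
  new-adj-v with v ≟ u | v ≟ v
  ... | yes _ | _ = refl
  ... | no _ | yes _ = refl
  ... | no _ | no ¬p = ⊥-elim (¬p refl)

  w-vu : w v u ≡ suc k
  w-vu = trans (w-sym v u) w-uv

  pull : ∀ X (φ : Fin (n G′) → Fin (n X)) →
         (∀ x y → adj G′ x y ≡ true → EWalk X (suc (w′ x y)) (φ x) (φ y)) →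
         ∀ x y → adj G x y ≡ true → EWalk X (suc (w x y)) (φ (suc x)) (φ (suc y))
  pull X φ h x y a with old-adj x y a
  ... | inj₂ a′ = h (suc x) (suc y) a′
  ... | inj₁ (inj₁ (refl , refl)) = subst (λ l → EWalk X l (φ (suc u)) (φ (suc v)))
    (trans (cong₂ (λ i j → suc i + suc j) toward-u toward-v) (cong suc (sym w-uv)))
    (wwalk-++ (h (suc u) zero new-adj-u) (h zero (suc v) new-adj-v))
  ... | inj₁ (inj₂ (refl , refl)) = subst (λ l → EWalk X l (φ (suc v)) (φ (suc u)))
    (trans (cong₂ (λ i j → suc i + suc j) toward-v toward-u) (cong suc (trans (+-comm k 1) (sym w-vu))))
    (wwalk-++ (h (suc v) zero new-adj-v) (h zero (suc u) new-adj-u))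

  -- The excess `i + i` comes from entering the subdivided edge and turning back at the new vertex.
  -- Being even, it leaves the parity unchanged.
  Shortened : ℕ → V → V → Set
  Shortened l x y = ∃ λ l′ → ∃ λ i → l ≡ l′ + (i + i) × WWalk G w l′ x y

  shortened-cons : ∀ {l m x y z} → adj G x y ≡ true → Shortened l y z → m ≡ suc (w x y + l) → Shortened m x z
  shortened-cons {x = x} {y} a (l′ , i , refl , p) refl =
    suc (w x y + l′) , i , cong suc (sym (+-assoc (w x y) l′ (i + i))) , cons a p refl

  shortened-skip : ∀ {l m x y} j → Shortened l x y → m ≡ (j + j) + l → Shortened m x y
  shortened-skip j (l′ , i , refl , p) refl = l′ , j + i , rearrange j l′ i , p
    where
    rearrange : ∀ j l′ i → (j + j) + (l′ + (i + i)) ≡ l′ + ((j + i) + (j + i))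
    rearrange = solve-∀

  FromNew : ℕ → V → Set
  FromNew l y = (∃ λ m → l ≡ suc m × Shortened m u y) ⊎ (∃ λ m → l ≡ suc k + m × Shortened m v y)

  from-old : ∀ {l x y} → WWalk G′ w′ l (suc x) (suc y) → Shortened l x y
  from-new : ∀ {l y} → WWalk G′ w′ l zero (suc y) → FromNew l y

  from-old nil = 0 , 0 , refl , nil
  from-old {x = x} (cons {y = suc z} a p eq) = shortened-cons (proj₁ (old-adj⁻ x z a)) (from-old p) eq
  from-old {x = x} (cons {k = m} {y = zero} a p refl) with new-adj⁻ x a | from-new p
  ... | inj₁ refl | inj₁ (m′ , refl , s) = shortened-skip 1 s (cong (λ i → suc (i + suc m′)) toward-u)
  ... | inj₁ refl | inj₂ (m′ , refl , s) = shortened-cons uv s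
        (trans (cong (λ i → suc (i + (suc k + m′))) toward-u) (cong (λ i → suc (i + m′)) (sym w-uv)))
  ... | inj₂ refl | inj₁ (m′ , refl , s) = shortened-cons (trans (adj-sym G v u) uv) s
        (trans (cong (λ i → suc (i + suc m′)) toward-v) (trans (cong suc (+-suc k m′)) (cong (λ i → suc (i + m′)) (sym w-vu))))
  ... | inj₂ refl | inj₂ (m′ , refl , s) = shortened-skip (suc k) s
        (trans (cong (λ i → suc (i + (suc k + m′))) toward-v) (cong suc (sym (+-assoc k (suc k) m′))))

  from-new (cons {k = m} {y = zero} () p eq)
  from-new (cons {k = m} {y = suc z} a p refl) with new-adj⁻ z a
  ... | inj₁ refl = inj₁ (m , cong (λ i → suc (i + m)) toward-u , from-old p)
  ... | inj₂ refl = inj₂ (m , cong (λ i → suc (i + m)) toward-v , from-old p)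

  girth-old : ∀ g → NoShortOdd G w g → ∀ l x → parity l ≡ 1ℙ → l ≤ g → ¬ WWalk G′ w′ l (suc x) (suc x)
  girth-old g none l x odd l≤g p with from-old p
  ... | l′ , i , refl , q = none l′ x
    (trans (sym (trans (Parity.+-homo-+ l′ (i + i)) (trans (cong (parity l′ ℙ+_) (parity-double i)) (Parity.+-identityʳ _)))) odd)
    (≤-trans (m≤m+n l′ (i + i)) l≤g) q

  girth : ∀ g → NoShortOdd G w g → NoShortOdd G′ w′ g
  girth g none l (suc x) odd l≤g p = girth-old g none l x odd l≤g p
  girth g none .0 zero () l≤g nil
  -- A closed walk from the new vertex is rotated to start at its second vertex, which is old.
  girth g none l zero odd l≤g (cons {y = suc z} a p refl) = girth-old g none l z odd l≤g
    (subst (λ m → WWalk G′ w′ m (suc z) (suc z)) (+-comm _ (suc (toward z))) (wwalk-++ p (wwalk-edge a)))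

subdivide : ∀ {G₀} G (w : Weight G) → Symmetric G w → IsSubdivisionOf G G₀ → Subdivided G₀ G w
subdivide {G₀} G w w-sym sub = start
  where
  -- `ps` lists the pairs still to be treated: every edge of positive weight must occur in one of
  -- its orientations.
  Covered : ∀ G → Weight G → ∀ {m} → (Fin m → Fin (n G) × Fin (n G)) → Set
  Covered G w ps = ∀ x y → adj G x y ≡ true → w x y ≡ 0 ⊎ ∃ λ i → ps i ≡ (x , y) ⊎ ps i ≡ (y , x)

  drop : ∀ {G w m} {ps : Fin (suc m) → Fin (n G) × Fin (n G)} → Symmetric G w → Covered G w ps →
         adj G (proj₁ (ps zero)) (proj₂ (ps zero)) ≡ false ⊎ w (proj₁ (ps zero)) (proj₂ (ps zero)) ≡ 0 →
         Covered G w (ps ∘ suc)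
  drop {G} {w} w-sym cov done x y a with cov x y a
  ... | inj₁ e = inj₁ e
  ... | inj₂ (suc i , e) = inj₂ (i , e)
  drop {G} {w} w-sym cov (inj₁ e′) x y a | inj₂ (zero , inj₁ eq) rewrite eq = ⊥-elim (true≢false a e′)
  drop {G} {w} w-sym cov (inj₁ e′) x y a | inj₂ (zero , inj₂ eq) rewrite eq = ⊥-elim (true≢false (trans (adj-sym G y x) a) e′)
  drop {G} {w} w-sym cov (inj₂ e′) x y a | inj₂ (zero , inj₁ eq) rewrite eq = inj₁ e′
  drop {G} {w} w-sym cov (inj₂ e′) x y a | inj₂ (zero , inj₂ eq) rewrite eq = inj₁ (trans (w-sym x y) e′)

  go : ∀ m G w → Symmetric G w → IsSubdivisionOf G G₀ → (ps : Fin m → Fin (n G) × Fin (n G)) → Covered G w ps → Subdivided G₀ G w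
  go-edge : ∀ m k G w → Symmetric G w → IsSubdivisionOf G G₀ → (ps : Fin (suc m) → Fin (n G) × Fin (n G)) → Covered G w ps →
            w (proj₁ (ps zero)) (proj₂ (ps zero)) ≡ k → Subdivided G₀ G w

  go zero G w w-sym sub ps cov = record
    { graph = G ; subdivision = sub
    ; pull = λ X f → proj₁ f , λ x y a → cons (proj₂ f x y a) nil (cong suc (zeros a))
    ; girth = λ g none l x odd l≤g p → none l x odd l≤g (weigh p) }
    where
    zeros : ∀ {x y} → adj G x y ≡ true → w x y ≡ 0
    zeros {x} {y} a with cov x y a
    ... | inj₁ e = e
    weigh : ∀ {l x y} → EWalk G l x y → WWalk G w l x y
    weigh nil = nil
    weigh (cons {k} a p refl) = cons a (weigh p) (cong (λ i → suc (i + k)) (sym (zeros a)))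
  go (suc m) G w w-sym sub ps cov = go-edge m _ G w w-sym sub ps cov refl

  go-edge m zero G w w-sym sub ps cov eq = go m G w w-sym sub (ps ∘ suc) (drop {G} {w} {ps = ps} w-sym cov (inj₂ eq))
  go-edge m (suc k) G w w-sym sub ps cov eq with adj G (proj₁ (ps zero)) (proj₂ (ps zero)) Bool.≟ true
  ... | no ¬a = go m G w w-sym sub (ps ∘ suc) (drop {G} {w} {ps = ps} w-sym cov (inj₁ (¬true⇒false ¬a)))
  ... | yes a = record
    { graph = R.graph ; subdivision = R.subdivision
    ; pull = λ X f → let φ , h = R.pull X f in φ ∘ suc , E.pull X φ h
    ; girth = λ g none → R.girth g (E.girth g none) }
    where
    u = proj₁ (ps zero)
    v = proj₂ (ps zero)
    module E = SubdivideEdge G w w-sym u v a k eq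
    -- The half that carries the remaining weight takes the place of the old edge: the list keeps
    -- its length while the weight of its head drops by one.
    ps′ : Fin (suc m) → Fin (suc (n G)) × Fin (suc (n G))
    ps′ zero = zero , suc v
    ps′ (suc i) = suc (proj₁ (ps (suc i))) , suc (proj₂ (ps (suc i)))
    cov′ : Covered E.G′ E.w′ ps′
    cov′ zero (suc y) a′ with E.new-adj⁻ y a′
    ... | inj₁ refl = inj₁ E.toward-u
    ... | inj₂ refl = inj₂ (zero , inj₁ refl)
    cov′ (suc x) zero a′ with E.new-adj⁻ x a′
    ... | inj₁ refl = inj₁ E.toward-u
    ... | inj₂ refl = inj₂ (zero , inj₂ refl)
    cov′ (suc x) (suc y) a′ with E.old-adj⁻ x y a′
    ... | b , ¬pair with cov x y b
    ... | inj₁ e = inj₁ e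
    ... | inj₂ (zero , inj₁ e) = ⊥-elim (¬pair (inj₁ (sym (cong proj₁ e) , sym (cong proj₂ e))))
    ... | inj₂ (zero , inj₂ e) = ⊥-elim (¬pair (inj₂ (sym (cong proj₂ e) , sym (cong proj₁ e))))
    ... | inj₂ (suc i , inj₁ e) = inj₂ (suc i , inj₁ (cong (λ p → suc (proj₁ p) , suc (proj₂ p)) e))
    ... | inj₂ (suc i , inj₂ e) = inj₂ (suc i , inj₂ (cong (λ p → suc (proj₁ p) , suc (proj₂ p)) e))
    module R = Subdivided (go-edge m k E.G′ E.w′ E.w′-sym (stepSub sub u v a) ps′ cov′ E.toward-v)

  start : Subdivided G₀ G w
  start = go (n G * n G) G w w-sym sub (remQuot (n G)) λ x y _ → inj₂ (combine x y , inj₁ (remQuot-combine x y))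

-- Closed walks and cycles

odd-parity : ∀ {k} → Odd k → parity k ≡ 1ℙ
odd-parity (t , refl) = trans (parity-suc (2 * t)) (cong _⁻¹ (trans (cong (λ i → parity (t + i)) (+-identityʳ t)) (parity-double t)))

parity-odd : ∀ k → parity k ≡ 1ℙ → Odd k
parity-odd (suc zero) _ = 0 , refl
parity-odd (suc (suc k)) eq with parity-odd k eq
... | t , refl = suc t , cong (λ i → suc (suc i)) (sym (+-suc t (t + 0)))

module _ {G : Graph} where
  private V = Fin (n G)

  cyclic-walk : ∀ k (c : Fin (suc k) → V) → (∀ j → adj G (c (inject₁ j)) (c (suc j)) ≡ true) →
                adj G (c (fromℕ k)) (c zero) ≡ true → EWalk G (suc k) (c zero) (c zero)
  cyclic-walk k c along close = subst (λ l → EWalk G l (c zero) (c zero)) (+-comm k 1) (wwalk-++ (path k c along) (wwalk-edge close))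
    where
    path : ∀ k (c : Fin (suc k) → V) → (∀ j → adj G (c (inject₁ j)) (c (suc j)) ≡ true) → EWalk G k (c zero) (c (fromℕ k))
    path zero c along = nil
    path (suc k) c along = cons (along zero) (path k (c ∘ suc) (along ∘ suc)) refl

  no-short-odd⇒girth : ∀ g → NoShortOdd G (λ _ _ → 0) g → OddGirthGT G g
  no-short-odd⇒girth g none k odd k≤g C = none (suc k) (C.c zero) (odd-parity odd) k≤g (cyclic-walk k C.c C.cons C.close)
    where module C = Cycle C

  trace : ∀ {k x y} → EWalk G k x y → ℕ → V
  trace {x = x} nil _ = x
  trace {x = x} (cons _ _ _) zero = x
  trace (cons _ p _) (suc i) = trace p i

  trace-start : ∀ {k x y} (p : EWalk G k x y) → trace p 0 ≡ x
  trace-start nil = refl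
  trace-start (cons _ _ _) = refl

  trace-end : ∀ {k x y} (p : EWalk G k x y) → trace p k ≡ y
  trace-end nil = refl
  trace-end (cons _ p refl) = trace-end p

  trace-adj : ∀ {k x y} (p : EWalk G k x y) i → i < k → adj G (trace p i) (trace p (suc i)) ≡ true
  trace-adj {x = x} (cons a p refl) zero _ = trans (cong (adj G x) (trace-start p)) a
  trace-adj (cons a p refl) (suc i) (s≤s i<k) = trace-adj p i i<k

  segment : (c : ℕ → V) → ∀ m i → (∀ j → j < i + m → adj G (c j) (c (suc j)) ≡ true) → EWalk G m (c i) (c (i + m))
  segment c zero i a = subst (EWalk G 0 (c i) ∘ c) (sym (+-identityʳ i)) nil
  segment c (suc m) i a = cons (a i (m<m+n i (s≤s z≤n)))
    (subst (EWalk G m (c (suc i)) ∘ c) (sym (+-suc i m)) (segment c m (suc i) (λ j j< → a j (≤-trans j< (≤-reflexive (sym (+-suc i m))))))) refl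

  -- An odd closed walk without repetition is a cycle. A repeated vertex splits it into two shorter
  -- closed walks, one of which is odd.
  girth⇒no-short-odd : ∀ g → OddGirthGT G g → NoShortOdd G (λ _ _ → 0) g
  girth⇒no-short-odd g girth k = go k k ≤-refl
    where
    go : ∀ fuel k → k ≤ fuel → ∀ x → parity k ≡ 1ℙ → k ≤ g → ¬ EWalk G k x x
    go (suc fuel) (suc k) (s≤s k≤) x odd k≤g p
      with any? (λ (i : Fin (suc k)) → any? (λ (j : Fin (suc k)) → (suc (toℕ i) ≤? toℕ j) ×-dec (trace p (toℕ i) ≟ trace p (toℕ j))))
    ... | no ¬repeat = girth k (parity-odd (suc k) odd) k≤g record
      { long = long k p odd ; c = trace p ∘ toℕ ; inj = inj
      ; cons = λ j → subst (λ i → adj G (trace p i) (trace p (suc (toℕ j))) ≡ true) (sym (toℕ-inject₁ j)) (trace-adj p (toℕ j) (m≤n⇒m≤1+n (toℕ<n j)))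
      ; close = subst₂ (λ y z → adj G y z ≡ true) (cong (trace p) (sym (toℕ-fromℕ k))) (trans (trace-end p) (sym (trace-start p))) (trace-adj p k ≤-refl) }
      where
      long : ∀ k → EWalk G (suc k) x x → parity (suc k) ≡ 1ℙ → 2 ≤ k
      long zero (cons a nil refl) _ = ⊥-elim (true≢false a (adj-irr G x))
      long (suc (suc k)) _ _ = s≤s (s≤s z≤n)
      inj : ∀ i j → trace p (toℕ i) ≡ trace p (toℕ j) → i ≡ j
      inj i j eq with <-cmp (toℕ i) (toℕ j)
      ... | tri< lt _ _ = ⊥-elim (¬repeat (i , j , lt , eq))
      ... | tri≈ _ e _ = toℕ-injective e
      ... | tri> _ _ gt = ⊥-elim (¬repeat (j , i , gt , sym eq))
    ... | yes (i , j , i<j , eq) = split (parity (suc d)) refl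
      where
      d = toℕ j ∸ suc (toℕ i)
      e = suc k ∸ toℕ j
      j≡ : toℕ i + suc d ≡ toℕ j
      j≡ = trans (+-suc (toℕ i) d) (m+[n∸m]≡n i<j)
      k≡ : toℕ j + e ≡ suc k
      k≡ = m+[n∸m]≡n (<⇒≤ (toℕ<n j))
      total : suc d + (toℕ i + e) ≡ suc k
      total = trans (rearrange (suc d) (toℕ i) e) (trans (cong (_+ e) j≡) k≡)
        where
        rearrange : ∀ a b c → a + (b + c) ≡ (b + a) + c
        rearrange = solve-∀
      inner : EWalk G (suc d) (trace p (toℕ i)) (trace p (toℕ i))
      inner = subst (EWalk G (suc d) (trace p (toℕ i))) (trans (cong (trace p) j≡) (sym eq))
        (segment (trace p) (suc d) (toℕ i) (λ l l< → trace-adj p l (≤-trans l< (≤-trans (≤-reflexive j≡) (<⇒≤ (toℕ<n j))))))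
      outer : EWalk G (toℕ i + e) x x
      outer = subst₂ (EWalk G (toℕ i + e)) (trace-start p) (trans (cong (trace p) k≡) (trace-end p))
        (wwalk-++ (subst (EWalk G (toℕ i) (trace p 0)) eq
                    (segment (trace p) (toℕ i) 0 (λ l l< → trace-adj p l (≤-trans l< (<⇒≤ (toℕ<n i))))))
                  (segment (trace p) e (toℕ j) (λ l l< → trace-adj p l (≤-trans l< (≤-reflexive k≡)))))
      inner≤ : suc d ≤ k
      inner≤ = ≤-trans (m≤n+m (suc d) (toℕ i)) (≤-trans (≤-reflexive j≡) (s≤s⁻¹ (toℕ<n j)))
      outer≤ : toℕ i + e ≤ k
      outer≤ = s≤s⁻¹ (≤-trans (s≤s (m≤n+m (toℕ i + e) d)) (≤-reflexive total))
      split : ∀ q → parity (suc d) ≡ q → ⊥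
      split 1ℙ eq′ = go fuel (suc d) (≤-trans inner≤ k≤) _ eq′ (≤-trans inner≤ (<⇒≤ k≤g)) inner
      split 0ℙ eq′ = go fuel (toℕ i + e) (≤-trans outer≤ k≤) x
        (trans (trans (cong (_ℙ+ parity (toℕ i + e)) (sym eq′)) (sym (Parity.+-homo-+ (suc d) (toℕ i + e)))) (trans (cong parity total) odd))
        (≤-trans outer≤ (<⇒≤ k≤g)) outer

  bounce : ∀ {k x y z} e → parity e ≡ 0ℙ → adj G x y ≡ true → EWalk G k x z → EWalk G (e + k) x z
  bounce zero _ a p = p
  bounce {x = x} {y} (suc (suc e)) even a p = cons a (cons (trans (adj-sym G y x) a) (bounce e even a p) refl) refl

  -- An odd walk is not empty, so the extra length can be spent going back and forth along its first
  -- edge.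
  lengthen : ∀ {k x} e → parity e ≡ 0ℙ → parity k ≡ 1ℙ → EWalk G k x x → EWalk G (e + k) x x
  lengthen e even odd p@(cons a _ _) = bounce e even a p

-- Odd cycles and their duals

module CycleGraph (m : ℕ) (2≤m : 2 ≤ m) where
  Next : Fin (suc m) → Fin (suc m) → Set
  Next i j = suc (toℕ i) ≡ toℕ j ⊎ (toℕ i ≡ m × toℕ j ≡ 0)

  edge? : ∀ i j → Dec (Next i j ⊎ Next j i)
  edge? i j = next? i j ⊎-dec next? j i
    where
    next? : ∀ i j → Dec (Next i j)
    next? i j = (suc (toℕ i) ℕ.≟ toℕ j) ⊎-dec ((toℕ i ℕ.≟ m) ×-dec (toℕ j ℕ.≟ 0))

  cycle : Graph
  cycle = record
    { n = suc m ; adj = λ i j → ⌊ edge? i j ⌋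
    ; adj-sym = λ i j → bool-ext (λ e → ⌊⌋-true (edge? j i) (swap (⌊⌋-true⁻ (edge? i j) e)))
                                 (λ e → ⌊⌋-true (edge? i j) (swap (⌊⌋-true⁻ (edge? j i) e)))
    ; adj-irr = λ i → ⌊⌋-false (edge? i i) [ irr i , irr i ]′ }
    where
    irr : ∀ i → ¬ Next i i
    irr i (inj₁ eq) = 1+n≢n eq
    irr i (inj₂ (p , q)) = contradiction (trans (sym p) q) (≢-sym (<⇒≢ (≤-trans (s≤s z≤n) 2≤m)))

  along : ∀ (j : Fin m) → adj cycle (inject₁ j) (suc j) ≡ true
  along j = ⌊⌋-true (edge? (inject₁ j) (suc j)) (inj₁ (inj₁ (cong suc (toℕ-inject₁ j))))

  connected : Connected cycle
  connected i j = _ , walk-++ (walk-reverse (proj₂ (from-zero _ i refl))) (proj₂ (from-zero _ j refl))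
    where
    from-zero : ∀ k i → toℕ i ≡ k → ∃ λ l → Walk cycle (λ _ → ⊤) l zero i
    from-zero zero zero _ = 0 , here tt
    from-zero (suc k) (suc i) eq with from-zero k (inject₁ i) (trans (toℕ-inject₁ i) (suc-injective eq))
    ... | l , w = suc l , walk-snoc w (along i) tt

  closed-walk : ∀ {G} → cycle ⟶ G → ∃ λ x → EWalk G (suc m) x x
  closed-walk (f , h) = f zero , cyclic-walk m f (λ j → h _ _ (along j))
    (h _ _ (⌊⌋-true (edge? (fromℕ m) zero) (inj₁ (inj₂ (toℕ-fromℕ m , refl)))))

  wrap : ∀ {G x} → EWalk G (suc m) x x → cycle ⟶ G
  wrap {G} {x} p = trace p ∘ toℕ , λ i j e → [ step-adj i j , (λ n → trans (adj-sym G _ _) (step-adj j i n)) ]′ (⌊⌋-true⁻ (edge? i j) e)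
    where
    step-adj : ∀ i j → Next i j → adj G (trace p (toℕ i)) (trace p (toℕ j)) ≡ true
    step-adj i j (inj₁ eq) = subst (λ l → adj G (trace p (toℕ i)) (trace p l) ≡ true) eq (trace-adj p (toℕ i) (toℕ<n i))
    step-adj i j (inj₂ (eq , eq′)) = subst₂ (λ k l → adj G (trace p k) l ≡ true) (sym eq)
      (trans (trace-end p) (trans (sym (trace-start p)) (cong (trace p) (sym eq′)))) (trace-adj p m ≤-refl)

-- A closed walk of length `suc m` is the same as a homomorphism from the cycle. An odd closed walk
-- of smaller length in `D` could be padded to that length, so the dual has large odd-girth; and a
-- graph of large odd-girth in `C` receives no such cycle, so it maps to `D`.
duality⇒universal : ∀ C → HasAllRestrictedDualities C → ∀ m → 2 ≤ m → Odd (suc m) →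
                    ∃ λ H → OddGirthGT H (suc m) × (∀ G → C G → OddGirthGT G (suc m) → G ⟶ H)
duality⇒universal C dual m 2≤m odd with dual cycle (s≤s z≤n) connected
  where open CycleGraph m 2≤m
... | D , cycle↛D , dual-D = D , no-short-odd⇒girth (suc m) girth-D , to-D
  where
  open CycleGraph m 2≤m
  girth-D : NoShortOdd D (λ _ _ → 0) (suc m)
  girth-D k x odd-k k≤ p = cycle↛D (wrap {D} (subst (λ l → EWalk D l x x) (m∸n+n≡m k≤) (lengthen (suc m ∸ k) even odd-k p)))
    where
    even : parity (suc m ∸ k) ≡ 0ℙ
    even = Parity.+-cancelʳ-≡ 1ℙ _ _ (trans (cong (parity (suc m ∸ k) ℙ+_) (sym odd-k))
      (trans (sym (Parity.+-homo-+ (suc m ∸ k) k)) (trans (cong parity (m∸n+n≡m k≤)) (odd-parity odd))))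
  to-D : ∀ G → C G → OddGirthGT G (suc m) → G ⟶ D
  to-D G G∈C girth with hom? G D
  ... | yes h = h
  ... | no ¬h with closed-walk {G} (proj₂ (dual-D G G∈C) ¬h)
  ... | x , p = ⊥-elim (girth⇒no-short-odd (suc m) girth (suc m) x (odd-parity odd) ≤-refl p)

-- From universal graphs to sparse minors

-- A record, so that `k` can be inferred from the type; an equation about `parity k` would not
-- determine it.
record Even (k : ℕ) : Set where
  constructor even
  field parity-even : parity k ≡ 0ℙ

even-double : ∀ k → Even (k + k)
even-double k = even (parity-double k)

-- Serves to concatenate walks: `e + e` is what the common endpoint contributes to both parts.
even-combine : ∀ {a b c} e → Even a → Even b → a + b ≡ c + (e + e) → Even c
even-combine {a} {b} {c} e (even even-a) (even even-b) eq = even (begin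
  parity c                        ≡⟨ Parity.+-identityʳ (parity c) ⟨
  parity c ℙ+ 0ℙ                  ≡⟨ cong (parity c ℙ+_) (parity-double e) ⟨
  parity c ℙ+ parity (e + e)      ≡⟨ Parity.+-homo-+ c (e + e) ⟨
  parity (c + (e + e))            ≡⟨ cong parity eq ⟨
  parity (a + b)                  ≡⟨ Parity.+-homo-+ a b ⟩
  parity a ℙ+ parity b            ≡⟨ cong₂ _ℙ+_ even-a even-b ⟩
  0ℙ                              ∎)
  where open ≡-Reasoning

least : ∀ {P : ℕ → Set} → (∀ k → Dec (P k)) → ∀ k → P k → ∃ λ d → d ≤ k × P d × (∀ j → P j → d ≤ j)
least P? zero p = 0 , z≤n , p , λ _ _ → z≤n
least P? (suc k) p with P? 0 | least (P? ∘ suc) k p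
... | yes p₀ | _ = 0 , z≤n , p₀ , λ _ _ → z≤n
... | no ¬p₀ | d , d≤ , pd , min = suc d , s≤s d≤ , pd , λ { zero q → ⊥-elim (¬p₀ q) ; (suc j) q → s≤s (min j q) }

-- The value ℓ is L + 2r with L = 4r + 2: removing two depths of at most r leaves an edge of length
-- at least L, and 3L = 2ℓ + 2 just exceeds 2ℓ + 1.
stretch : ℕ → ℕ
stretch r = suc (suc (4 * r)) + (r + r)

-- Subdividing along a shallow minor: walks between adjacent centres get length ℓ + ι (b u v),
-- while closed walks of odd length stay longer than ℓ + suc ℓ.
module Stretch {r : ℕ} {H G : Graph} (M : ShallowMinor r H G) (b : Fin (n H) → Fin (n H) → Bool)
               (b-sym : ∀ u v → b u v ≡ b v u) where
  open ShallowMinor M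
  private
    V = Fin (n G)
    L ℓ : ℕ
    L = suc (suc (4 * r))
    ℓ = stretch r

  -- The prescribed distances between classes. The vertices outside all branch sets form one further
  -- class, `nothing`.
  κ : Maybe (Fin (n H)) → Maybe (Fin (n H)) → ℕ
  κ (just u) (just v) = ℓ + ι (b u v)
  κ _ _ = ℓ

  κ-sym : ∀ α β → κ α β ≡ κ β α
  κ-sym (just u) (just v) = cong (λ c → ℓ + ι c) (b-sym u v)
  κ-sym (just u) nothing = refl
  κ-sym nothing (just v) = refl
  κ-sym nothing nothing = refl

  ℓ≤κ : ∀ α β → ℓ ≤ κ α β
  ℓ≤κ (just u) (just v) = m≤m+n ℓ _
  ℓ≤κ (just u) nothing = ≤-refl
  ℓ≤κ nothing _ = ≤-refl

  -- The distance to the centre inside the branch set, set to 0 outside all branch sets.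
  depth-data : ∀ x → ∃ λ d → d ≤ r × (∀ v → σ x ≡ just v → Walk G (λ y → σ y ≡ just v) d x (center v) ×
                                   (∀ k → Walk G (λ y → σ y ≡ just v) k x (center v) → d ≤ k))
  depth-data x with σ x in eq
  ... | nothing = 0 , z≤n , λ _ ()
  ... | just v with least (λ k → walk? (λ y → ≡-dec _≟_ (σ y) (just v)) k x (center v)) r (walk-reverse (radius v x eq))
  ... | d , d≤ , w , min = d , d≤ , λ { .v refl → w , min }

  abstract
    depth : V → ℕ
    depth x = proj₁ (depth-data x)

    depth≤ : ∀ x → depth x ≤ r
    depth≤ x = proj₁ (proj₂ (depth-data x))

    depth-walk : ∀ x v → σ x ≡ just v → Walk G (λ y → σ y ≡ just v) (depth x) x (center v)
    depth-walk x v eq = proj₁ (proj₂ (proj₂ (depth-data x)) v eq)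

    depth-least : ∀ x v → σ x ≡ just v → ∀ k → Walk G (λ y → σ y ≡ just v) k x (center v) → depth x ≤ k
    depth-least x v eq = proj₂ (proj₂ (proj₂ (depth-data x)) v eq)

  same? : ∀ x y → Dec (σ x ≡ σ y)
  same? x y = ≡-dec _≟_ (σ x) (σ y)

  even? : ∀ k → Dec (Even k)
  even? k = map′ even Even.parity-even (parity k Parity.≟ 0ℙ)

  parity-suc-even : ∀ k → ¬ Even k → Even (suc k)
  parity-suc-even k ne with parity k in eqk | parity-suc k
  ... | 0ℙ | _ = ⊥-elim (ne (even eqk))
  ... | 1ℙ | eq = even eq

  depths≤ : ∀ x y → depth x + depth y ≤ r + r
  depths≤ x y = +-mono-≤ (depth≤ x) (depth≤ y)

  abstract
    -- Inside a class the length 1 or 2 is chosen to have the parity of the sum of the depths.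
    -- Between classes it is what remains of `κ` once both ends have been walked to their centres.
    w : Weight G
    w x y with same? x y | even? (depth x + depth y)
    ... | yes _ | yes _ = 1
    ... | yes _ | no _ = 0
    ... | no _ | _ = κ (σ x) (σ y) ∸ suc (depth x + depth y)

    w-sym : Symmetric G w
    w-sym x y with same? x y | same? y x | even? (depth x + depth y) | even? (depth y + depth x)
    ... | yes p | no q | _ | _ = ⊥-elim (q (sym p))
    ... | no p | yes q | _ | _ = ⊥-elim (p (sym q))
    ... | yes _ | yes _ | yes _ | yes _ = refl
    ... | yes _ | yes _ | yes e | no o = ⊥-elim (o (subst Even (+-comm (depth x) (depth y)) e))
    ... | yes _ | yes _ | no o | yes e = ⊥-elim (o (subst Even (+-comm (depth y) (depth x)) e))
    ... | yes _ | yes _ | no _ | no _ = refl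
    ... | no _ | no _ | _ | _ = cong₂ (λ i j → i ∸ suc j) (κ-sym (σ x) (σ y)) (+-comm (depth x) (depth y))

    w-same : ∀ x y → σ x ≡ σ y → Even (suc (w x y) + (depth x + depth y))
    w-same x y eq with same? x y | even? (depth x + depth y)
    ... | no ne | _ = ⊥-elim (ne eq)
    ... | yes _ | yes e = even (Even.parity-even e)
    ... | yes _ | no o = parity-suc-even _ o

    w-odd : ∀ x y → σ x ≡ σ y → ¬ Even (depth x + depth y) → w x y ≡ 0
    w-odd x y eq o with same? x y | even? (depth x + depth y)
    ... | no ne | _ = ⊥-elim (ne eq)
    ... | yes _ | yes e = ⊥-elim (o e)
    ... | yes _ | no _ = refl

    w-cross : ∀ x y → ¬ σ x ≡ σ y → suc (w x y) + (depth x + depth y) ≡ κ (σ x) (σ y)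
    w-cross x y ne with same? x y
    ... | yes eq = ⊥-elim (ne eq)
    ... | no _ = trans (sym (+-suc _ _)) (m∸n+n≡m (≤-trans (s≤s (depths≤ x y))
                   (≤-trans (+-monoˡ-≤ (r + r) {1} {L} (s≤s z≤n)) (ℓ≤κ (σ x) (σ y)))))

  w-cross-≤ : ∀ x y → ¬ σ x ≡ σ y → L ≤ suc (w x y)
  w-cross-≤ x y ne = +-cancelʳ-≤ (r + r) L _ (≤-trans (ℓ≤κ (σ x) (σ y))
    (≤-trans (≤-reflexive (sym (w-cross x y ne))) (+-monoʳ-≤ (suc (w x y)) (depths≤ x y))))

  w-cross-even : ∀ x y → ¬ σ x ≡ σ y → Even (κ (σ x) (σ y) + (suc (w x y) + (depth x + depth y)))
  w-cross-even x y ne = subst (λ i → Even (κ (σ x) (σ y) + i)) (sym (w-cross x y ne)) (even-double (κ (σ x) (σ y)))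

  -- Walks from x to z of length k, by the number of times that they change branch sets.
  data Crossings (k : ℕ) (x z : V) : Set where
    none : σ x ≡ σ z → Even (k + (depth x + depth z)) → Crossings k x z
    one : ¬ σ x ≡ σ z → Even (κ (σ x) (σ z) + (k + (depth x + depth z))) → L ≤ k → Crossings k x z
    two : (σ x ≡ σ z → Even (k + (depth x + depth z))) → L + L ≤ k → Crossings k x z
    many : L + (L + L) ≤ k → Crossings k x z

  step-same : ∀ a x y k z → (a + (x + y)) + (k + (y + z)) ≡ ((a + k) + (x + z)) + (y + y)
  step-same = solve-∀

  step-same′ : ∀ c a x y k z → (a + (x + y)) + (c + (k + (y + z))) ≡ (c + ((a + k) + (x + z))) + (y + y)
  step-same′ = solve-∀

  step-cross : ∀ c a x y k z → (c + (a + (x + y))) + (k + (y + z)) ≡ (c + ((a + k) + (x + z))) + (y + y)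
  step-cross = solve-∀

  step-cross′ : ∀ c a x y k z → (c + (a + (x + y))) + (c + (k + (y + z))) ≡ ((a + k) + (x + z)) + ((c + y) + (c + y))
  step-cross′ = solve-∀

  -- Lengths are corrected by the depths of the endpoints. Then steps inside a class are even and a
  -- crossing has the parity of `κ`; two crossings that return to the first class use the same value
  -- of `κ` by symmetry, so they cancel.
  crossings : ∀ {k x z} → WWalk G w k x z → Crossings k x z
  crossings {x = x} nil = none refl (even-double (depth x))
  crossings {x = x} {z} (cons {k} {y = y} a p refl) with same? x y | crossings p
  ... | yes eq | none eq′ e = none (trans eq eq′)
        (even-combine (depth y) (w-same x y eq) e (step-same (suc (w x y)) (depth x) (depth y) k (depth z)))
  ... | yes eq | one ne e L≤ = one (ne ∘ trans (sym eq))
        (even-combine (depth y) (w-same x y eq) (subst (λ α → Even (κ α (σ z) + (k + (depth y + depth z)))) (sym eq) e)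
          (step-same′ (κ (σ x) (σ z)) (suc (w x y)) (depth x) (depth y) k (depth z)))
        (≤-trans L≤ (m≤n+m k _))
  ... | yes eq | two e L≤ = two
        (λ eq′ → even-combine (depth y) (w-same x y eq) (e (trans (sym eq) eq′)) (step-same (suc (w x y)) (depth x) (depth y) k (depth z)))
        (≤-trans L≤ (m≤n+m k _))
  ... | yes eq | many L≤ = many (≤-trans L≤ (m≤n+m k _))
  ... | no ne | none eq′ e = one (λ eq → ne (trans eq (sym eq′)))
        (even-combine (depth y) (subst (λ α → Even (κ (σ x) α + (suc (w x y) + (depth x + depth y)))) eq′ (w-cross-even x y ne)) e
          (step-cross (κ (σ x) (σ z)) (suc (w x y)) (depth x) (depth y) k (depth z)))
        (≤-trans (w-cross-≤ x y ne) (m≤m+n _ k))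
  ... | no ne | one ne′ e L≤ = two
        (λ eq → even-combine (κ (σ x) (σ y) + depth y) (w-cross-even x y ne)
          (subst (λ i → Even (i + (k + (depth y + depth z)))) (trans (cong (κ (σ y)) (sym eq)) (κ-sym (σ y) (σ x))) e)
          (step-cross′ (κ (σ x) (σ y)) (suc (w x y)) (depth x) (depth y) k (depth z)))
        (+-mono-≤ (w-cross-≤ x y ne) L≤)
  ... | no ne | two _ L≤ = many (+-mono-≤ (w-cross-≤ x y ne) L≤)
  ... | no ne | many L≤ = many (≤-trans L≤ (m≤n+m k _))

  ¬even-odd : ∀ k x → Even (k + (depth x + depth x)) → ¬ parity k ≡ 1ℙ
  ¬even-odd k x e odd = contradiction
    (trans (sym odd) (Even.parity-even (even-combine {b = 0} {c = k} (depth x) e (even refl) (+-identityʳ _)))) λ ()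

  no-short-odd : NoShortOdd G w (ℓ + suc ℓ)
  no-short-odd k x odd k≤ p with crossings p
  ... | none _ e = ¬even-odd k x e odd
  ... | one ne _ _ = ne refl
  ... | two e _ = ¬even-odd k x (e refl) odd
  ... | many L≤ = <⇒≱ (≤-reflexive (long r)) (≤-trans L≤ k≤)
    where
    long : ∀ r → suc ((suc (suc (4 * r)) + (r + r)) + suc (suc (suc (4 * r)) + (r + r))) ≡ suc (suc (4 * r)) + (suc (suc (4 * r)) + suc (suc (4 * r)))
    long = solve-∀

  module Pulled (X : Graph) (φ : V → Fin (n X)) (h : ∀ x y → adj G x y ≡ true → EWalk X (suc (w x y)) (φ x) (φ y)) where

    -- Along a shortest walk to the centre the depth falls by one at each step, so consecutive
    -- depths have odd sum and these edges have weight 0.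
    to-centre : ∀ d x v → σ x ≡ just v → depth x ≡ d → EWalk X d (φ x) (φ (center v))
    to-centre d x v eq eqd = go d x eq eqd (subst (λ k → Walk G (λ y → σ y ≡ just v) k x (center v)) eqd (depth-walk x v eq))
      where
      go : ∀ d x → σ x ≡ just v → depth x ≡ d → Walk G (λ y → σ y ≡ just v) d x (center v) → EWalk X d (φ x) (φ (center v))
      go d x eq eqd (here p) with trans (sym eqd) (n≤0⇒n≡0 (depth-least x v eq 0 (here p)))
      ... | refl = nil
      go (suc d) x eq eqd (step {y = y} p a wk) =
        cons-walk (subst (λ i → EWalk X (suc i) (φ x) (φ y)) (w-odd x y (trans eq (sym eq′)) odd) (h x y a))
                  (go d y eq′ eqd′ wk)
        where
        cons-walk : ∀ {k x y z} → EWalk X 1 x y → EWalk X k y z → EWalk X (suc k) x z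
        cons-walk = wwalk-++
        eq′ : σ y ≡ just v
        eq′ = walk-start wk
        eqd′ : depth y ≡ d
        eqd′ = ≤-antisym (depth-least y v eq′ d wk)
          (s≤s⁻¹ (≤-trans (≤-reflexive (sym eqd)) (depth-least x v eq _ (step p a (depth-walk y v eq′)))))
        odd : ¬ Even (depth x + depth y)
        odd (even e) = contradiction (trans (sym e) (trans (cong₂ (λ i j → parity (i + j)) eqd eqd′)
                  (trans (parity-suc (d + d)) (cong _⁻¹ (parity-double d))))) λ ()

    between-centres : ∀ u v → adj H u v ≡ true → EWalk X (ℓ + ι (b u v)) (φ (center u)) (φ (center v))
    between-centres u v e with edges u v e
    ... | x , y , eqx , eqy , a = subst (λ k → EWalk X k (φ (center u)) (φ (center v))) total
      (wwalk-++ (wwalk-reverse (λ _ _ → refl) (to-centre _ x u eqx refl)) (wwalk-++ (h x y a) (to-centre _ y v eqy refl)))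
      where
      ne : ¬ σ x ≡ σ y
      ne eq with just-injective (trans (sym eqx) (trans eq eqy))
      ... | refl = true≢false e (adj-irr H u)
      rearrange : ∀ x a y → x + (a + y) ≡ a + (x + y)
      rearrange = solve-∀
      total : depth x + (suc (w x y) + depth y) ≡ ℓ + ι (b u v)
      total = trans (rearrange (depth x) (suc (w x y)) (depth y)) (trans (w-cross x y ne) (cong₂ κ eqx eqy))

-- Counting sets of edges

sum-++ : ∀ a {b} (f : Fin (a + b) → ℕ) → sum f ≡ sum (λ i → f (i ↑ˡ b)) + sum (λ j → f (a ↑ʳ j))
sum-++ zero f = refl
sum-++ (suc a) f = trans (cong (f zero +_) (sum-++ a (f ∘ suc))) (sym (+-assoc (f zero) _ _))

sum-combine : ∀ a b (f : Fin (a * b) → ℕ) → sum f ≡ sum (λ i → sum (λ j → f (combine {a} {b} i j)))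
sum-combine zero b f = refl
sum-combine (suc a) b f = trans (sum-++ b f) (cong (sum (λ j → f (j ↑ˡ (a * b))) +_) (sum-combine a b (λ i → f (b ↑ʳ i))))

unbit-injective : ∀ {x y} → unbit x ≡ unbit y → x ≡ y
unbit-injective {zero} {zero} _ = refl
unbit-injective {suc zero} {suc zero} _ = refl

funToFin-cong : ∀ {k m} {f g : Fin k → Fin m} → (∀ i → f i ≡ g i) → funToFin f ≡ funToFin g
funToFin-cong {zero} h = refl
funToFin-cong {suc k} h = cong₂ combine (h zero) (funToFin-cong (h ∘ suc))

decode-injective : ∀ {m} (c c′ : Fin (2 ^ m)) → (∀ i → decode c i ≡ decode c′ i) → c ≡ c′
decode-injective {m} c c′ h = trans (sym (funToFin-finToFin {m} {2} c))
  (trans (funToFin-cong {m} {2} (λ i → unbit-injective (h i))) (funToFin-finToFin {m} {2} c′))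

n<2^n : ∀ k → k < 2 ^ k
n<2^n zero = s≤s z≤n
n<2^n (suc k) = ≤-trans (s≤s (n<2^n k)) (≤-trans (+-monoˡ-≤ (2 ^ k) (≤-trans (s≤s z≤n) (n<2^n k))) (≤-reflexive (cong (2 ^ k +_) (sym (+-identityʳ (2 ^ k))))))

2^-reflects-≤ : ∀ a b → 2 ^ a ≤ 2 ^ b → a ≤ b
2^-reflects-≤ a b le = ≮⇒≥ (λ b<a → <⇒≱ (^-monoʳ-< 2 (s≤s (s≤s z≤n)) b<a) le)

-- Listing each edge once, from the smaller to the larger endpoint, lets every bit string of length
-- `size` be realised as a symmetric marking of the edges.
module UpwardEdges (H : Graph) where
  Upward : Fin (n H) × Fin (n H) → Set
  Upward (u , v) = adj H u v ≡ true × toℕ u < toℕ v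

  upward? : ∀ p → Dec (Upward p)
  upward? (u , v) = (adj H u v Bool.≟ true) ×-dec (toℕ u <? toℕ v)

  upward : Subset (n H * n H)
  upward e = ⌊ upward? (remQuot (n H) e) ⌋

  upward-combine : ∀ u v → upward (combine u v) ≡ ⌊ upward? (u , v) ⌋
  upward-combine u v = cong (λ p → ⌊ upward? p ⌋) (remQuot-combine u v)

  degreeSum-≤ : degreeSum H ≤ count upward + count upward
  degreeSum-≤ = begin
    degreeSum H                                                      ≡⟨ degreeSum-sum H ⟩
    sum (λ u → count (adj H u))                                      ≤⟨ sum-mono-≤ (λ u → sum-mono-≤ (λ v → bound u v)) ⟩
    sum (λ u → sum (λ v → up u v + up v u))                          ≡⟨ sum-cong-≗ (λ u → ∑-distrib-+ (up u) (λ v → up v u)) ⟩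
    sum (λ u → sum (up u) + sum (λ v → up v u))                      ≡⟨ ∑-distrib-+ (λ u → sum (up u)) (λ u → sum (λ v → up v u)) ⟩
    sum (λ u → sum (up u)) + sum (λ u → sum (λ v → up v u))          ≡⟨ cong (sum (λ u → sum (up u)) +_) (∑-comm (λ u v → up v u)) ⟩
    sum (λ u → sum (up u)) + sum (λ v → sum (up v))                  ≡⟨ cong₂ _+_ total total ⟩
    count upward + count upward                                      ∎
    where
    open ≤-Reasoning
    up : Fin (n H) → Fin (n H) → ℕ
    up u v = ι ⌊ upward? (u , v) ⌋
    total : sum (λ u → sum (up u)) ≡ count upward
    total = sym (trans (sum-combine (n H) (n H) (ι ∘ upward)) (sum-cong-≗ (λ u → sum-cong-≗ (λ v → cong ι (upward-combine u v)))))
    bound : ∀ u v → ι (adj H u v) ≤ up u v + up v u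
    bound u v = go (adj H u v) refl
      where
      go : ∀ b → adj H u v ≡ b → ι b ≤ up u v + up v u
      go false _ = z≤n
      go true e with <-cmp (toℕ u) (toℕ v)
      ... | tri< lt _ _ = ≤-trans (≤-reflexive (cong ι (sym (⌊⌋-true (upward? (u , v)) (e , lt))))) (m≤m+n (up u v) (up v u))
      ... | tri> _ _ gt = ≤-trans (≤-reflexive (cong ι (sym (⌊⌋-true (upward? (v , u)) (trans (adj-sym H v u) e , gt))))) (m≤n+m (up v u) (up u v))
      ... | tri≈ _ eq _ with toℕ-injective eq
      ... | refl = ⊥-elim (true≢false e (adj-irr H u))

  open Enum (enum upward) public

  source target : Fin size → Fin (n H)
  source i = proj₁ (remQuot (n H) (en i))
  target i = proj₂ (remQuot {n H} (n H) (en i))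

  en-combine : ∀ i → combine (source i) (target i) ≡ en i
  en-combine i = combine-remQuot {n H} (n H) (en i)

  en-upward : ∀ i → Upward (source i , target i)
  en-upward i = ⌊⌋-true⁻ (upward? (source i , target i)) (en-∈ i)

  module _ (s : Fin size → Bool) where
    Marked : Fin (n H) → Fin (n H) → Set
    Marked u v = ∃ λ i → source i ≡ u × target i ≡ v × s i ≡ true

    marked? : ∀ u v → Dec (Marked u v)
    marked? u v = any? (λ i → (source i ≟ u) ×-dec (target i ≟ v) ×-dec (s i Bool.≟ true))

    marking : Fin (n H) → Fin (n H) → Bool
    marking u v = ⌊ marked? u v ⌋ ∨ ⌊ marked? v u ⌋

    marking-sym : ∀ u v → marking u v ≡ marking v u
    marking-sym u v = ∨-comm ⌊ marked? u v ⌋ ⌊ marked? v u ⌋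

    marking-edge : ∀ i → marking (source i) (target i) ≡ s i
    marking-edge i = trans (cong₂ _∨_ forward (⌊⌋-false (marked? (target i) (source i)) backward)) (∨-identityʳ (s i))
      where
      backward : ¬ Marked (target i) (source i)
      backward (j , p , q , _) = <-asym (proj₂ (en-upward i))
        (subst₂ (λ u v → toℕ u < toℕ v) p q (proj₂ (en-upward j)))
      forward : ⌊ marked? (source i) (target i) ⌋ ≡ s i
      forward = bool-ext to (λ h → ⌊⌋-true (marked? (source i) (target i)) (i , refl , refl , h))
        where
        to : ⌊ marked? (source i) (target i) ⌋ ≡ true → s i ≡ true
        to h with ⌊⌋-true⁻ (marked? (source i) (target i)) h
        ... | j , p , q , sj = subst (λ k → s k ≡ true)
          (en-injective (trans (sym (en-combine j)) (trans (cong₂ combine p q) (en-combine i)))) sj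

id-iso : ∀ G → G ≅ G
id-iso G = ⤖-id (Fin (n G)) , λ _ _ → refl

module _ {C : Class} (closed : TopologicallyClosed C) where

  minor-sparse : ∀ r X → OddGirthGT X (stretch r + suc (stretch r)) →
    (∀ G → C G → OddGirthGT G (stretch r + suc (stretch r)) → G ⟶ X) →
    ∀ G H → C G → ShallowMinor r H G → degreeSum H ≤ (n X + n X) * n H
  minor-sparse r X girth-X universal G H G∈C M = begin
    degreeSum H                    ≤⟨ degreeSum-≤ ⟩
    count upward + count upward    ≡⟨ cong₂ _+_ size≡count size≡count ⟨
    size + size                    ≤⟨ +-mono-≤ size≤ size≤ ⟩
    n X * n H + n X * n H          ≡⟨ *-distribʳ-+ (n H) (n X) (n X) ⟨
    (n X + n X) * n H              ∎
    where
    open ≤-Reasoning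
    open UpwardEdges H
    open ShallowMinor M using (center)

    abstract
      coloured : ∀ s → ∃ λ (α : Fin (n H) → Fin (n X)) → ∀ u v → adj H u v ≡ true → EWalk X (stretch r + ι (marking s u v)) (α u) (α v)
      coloured s = let φ , h = D.pull X f in φ ∘ center , S.Pulled.between-centres X φ h
        where
        module S = Stretch M (marking s) (marking-sym s)
        module D = Subdivided (subdivide {G} G S.w S.w-sym (isoSub {G} {G} (id-iso G)))
        f : D.graph ⟶ X
        f = universal D.graph (closed D.graph G G∈C D.subdivision)
              (no-short-odd⇒girth {D.graph} (stretch r + suc (stretch r)) (D.girth (stretch r + suc (stretch r)) S.no-short-odd))

    code : Fin (2 ^ size) → Fin (n X ^ n H)
    code c = funToFin (proj₁ (coloured (decode {size} c)))

    -- Walks of lengths ℓ and ℓ + 1 between the same two vertices would close up to a short odd walk.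
    clash : ∀ {x y} → EWalk X (stretch r) x y → EWalk X (suc (stretch r)) x y → ⊥
    clash {x} p q = girth⇒no-short-odd (stretch r + suc (stretch r)) girth-X (stretch r + suc (stretch r)) x
      (trans (cong parity (+-suc (stretch r) (stretch r))) (trans (parity-suc (stretch r + stretch r)) (cong _⁻¹ (parity-double (stretch r)))))
      ≤-refl (wwalk-++ p (wwalk-reverse (λ _ _ → refl) q))

    same-mark : ∀ {x y} b b′ → EWalk X (stretch r + ι b) x y → EWalk X (stretch r + ι b′) x y → b ≡ b′
    same-mark true true p q = refl
    same-mark false false p q = refl
    same-mark {x} {y} true false p q = ⊥-elim (clash (subst (λ k → EWalk X k x y) (+-identityʳ _) q) (subst (λ k → EWalk X k x y) (+-comm _ 1) p))
    same-mark {x} {y} false true p q = ⊥-elim (clash (subst (λ k → EWalk X k x y) (+-identityʳ _) p) (subst (λ k → EWalk X k x y) (+-comm _ 1) q))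

    code-injective : ∀ {c c′} → code c ≡ code c′ → c ≡ c′
    code-injective {c} {c′} eq = decode-injective {size} c c′ λ i →
      trans (sym (marking-edge (decode {size} c) i)) (trans (same i) (marking-edge (decode {size} c′) i))
      where
      α α′ : Fin (n H) → Fin (n X)
      α = proj₁ (coloured (decode {size} c))
      α′ = proj₁ (coloured (decode {size} c′))
      agree : ∀ u → α u ≡ α′ u
      agree u = trans (sym (finToFun-funToFin α u)) (trans (cong (λ k → finToFun {n X} {n H} k u) eq) (finToFun-funToFin α′ u))
      same : ∀ i → marking (decode {size} c) (source i) (target i) ≡ marking (decode {size} c′) (source i) (target i)
      same i = same-mark _ _ (proj₂ (coloured (decode {size} c)) (source i) (target i) e)
        (subst₂ (EWalk X (stretch r + ι (marking (decode {size} c′) (source i) (target i)))) (sym (agree (source i))) (sym (agree (target i)))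
          (proj₂ (coloured (decode {size} c′)) (source i) (target i) e))
        where e = proj₁ (en-upward i)

    -- Bounding `n X` by `2 ^ n X` brings both sides to base 2, so that exponents can be compared.
    size≤ : size ≤ n X * n H
    size≤ = 2^-reflects-≤ size (n X * n H) (≤-trans (injective⇒≤ {f = code} code-injective)
      (≤-trans (^-monoˡ-≤ (n H) (<⇒≤ (n<2^n (n X)))) (≤-reflexive (^-*-assoc 2 (n X) (n H)))))

-- The case of length one and the equivalences

UniversalAt : Class → ℕ → Set
UniversalAt C g = ∃ λ H → OddGirthGT H g × (∀ G → C G → OddGirthGT G g → G ⟶ H)

complete : ℕ → Graph
complete m = record
  { n = m ; adj = λ i j → not ⌊ i ≟ j ⌋
  ; adj-sym = λ i j → bool-ext (symm i j) (symm j i)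
  ; adj-irr = λ i → cong not (⌊⌋-true (i ≟ i) refl) }
  where
  symm : ∀ (i j : Fin m) → not ⌊ i ≟ j ⌋ ≡ true → not ⌊ j ≟ i ⌋ ≡ true
  symm i j e with i ≟ j
  ... | no i≢j = cong not (⌊⌋-false (j ≟ i) (i≢j ∘ sym))

-- Minors of depth 0 include all induced subgraphs, so `G` is degenerate.
sparse-colouring : ∀ G c → Sparse G 0 c → G ⟶ complete (suc c)
sparse-colouring G c sparse =
  let χ , proper = degenerate-colouring c (adj G) (adj-sym G) (adj-irr G) (induced-sparse {c = c} sparse whole)
  in χ , λ u v e → cong not (⌊⌋-false (χ u ≟ χ v) (proper u v e))
  where
  whole : Contracted {G} {0} (singletons full)
  whole = record { E = adj G ; E-sym = adj-sym G ; E-irr = adj-irr G ; E-edge = λ u v e → refl , u , v , refl , refl , e }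

universal-one : ∀ C → BoundedExpansion C → UniversalAt C 1
universal-one C be = complete (suc (proj₁ (be 0))) , (λ { zero _ _ K → contradiction (Cycle.long K) λ () ; (suc k) _ (s≤s ()) })
  , λ G G∈C _ → sparse-colouring G (proj₁ (be 0)) (λ H → proj₂ (be 0) G H G∈C)

-- Stated for lengths from 3 on, which are those that duals of cycles supply, so that length 1 can
-- be derived from the conclusion without circularity.
universal⇒bounded-expansion : ∀ C → TopologicallyClosed C → (∀ m → 2 ≤ m → Odd (suc m) → UniversalAt C (suc m)) → BoundedExpansion C
universal⇒bounded-expansion C closed universal r
  with subst (UniversalAt C) (sym (+-suc (stretch r) (stretch r)))
         (universal (stretch r + stretch r) (≤-trans (s≤s (s≤s z≤n)) (m≤m+n (stretch r) (stretch r)))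
           (stretch r , cong (λ i → suc (stretch r + i)) (sym (+-identityʳ (stretch r)))))
... | X , girth-X , to-X = n X + n X , λ G H → minor-sparse {C} closed r X girth-X to-X G H

theorem8 : (C : Class) → TopologicallyClosed C →
    (BoundedExpansion C ⇔ HasAllRestrictedDualities C) ×
    (HasAllRestrictedDualities C ⇔ HomUniversalOddGirth C)
theorem8 C closed = mk⇔ (duality C) dual⇒be , mk⇔ dual⇒universal (duality C ∘ universal⇒be)
  where
  dual⇒be : HasAllRestrictedDualities C → BoundedExpansion C
  dual⇒be dual = universal⇒bounded-expansion C closed (duality⇒universal C dual)
  universal⇒be : HomUniversalOddGirth C → BoundedExpansion C
  universal⇒be universal = universal⇒bounded-expansion C closed (λ m _ → universal (suc m))
  dual⇒universal : HasAllRestrictedDualities C → HomUniversalOddGirth C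
  dual⇒universal dual _ (zero , refl) = universal-one C (dual⇒be dual)
  dual⇒universal dual _ (suc t , refl) = duality⇒universal C dual (2 * suc t) (m≤m*n 2 (suc t)) (suc t , refl)
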